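{- Let $f:2^{[n]}\to\mathbb{R}_+$ be a non-increasing weakly-$\alpha$-supermodular set function, let $k$ be a positive integer, let $S^*$ be an optimal solution of $\min\{f(S): S\subseteq[n],\ |S|\le k\}$, let $S_0\subseteq[n]$ with $f(S_0)>0$, let $E>0$, and put $\tau=\lceil \alpha k\ln(f(S_0)/E)\rceil$, assumed to satisfy $\tau\ge 0$. Let $S_\tau$ be the output of the Greedy Extension Algorithm run with input $f,S_0,k,E$. Then $$|S_\tau|\le |S_0|+\lceil \alpha k\ln(f(S_0)/E)\rceil\qquad\text{and}\qquad f(S_\tau)\le f(S^*)+E .$$
   Context: $[n]=\{1,\dots,n\}$ and $\mathbb{R}_+$ is the set of non-negative reals. A set function $f:2^{[n]}\to\mathbb{R}_+$ is non-increasing if $f(S\cup T)\le f(S)$ for all $S,T\subseteq[n]$. A non-negative non-increasing set function $f$ is weakly-$\alpha$-supermodular, where $\alpha\ge 1$, if for all $S,T\subseteq[n]$ $$f(S)-f(S\cup T)\le \alpha\cdot|T\setminus S|\cdot\max_{i\in T\setminus S}[f(S)-f(S\cup\{i\})],$$ where the right-hand side is read as $0$ when $T\setminus S=\emptyset$. Greedy Extension Algorithm with input $f,S_0,k,E$: for $t=1,\dots,\tau$, where $\tau=\lceil \alpha k\ln(f(S_0)/E)\rceil$, set $S_t=S_{t-1}\cup\{i_t\}$, where $i_t$ is any element of $\arg\min_{i\in[n]} f(S_{t-1}\cup\{i\})$; output $S_\tau$. -}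

module Defs where

open import Algebra.Bundles using (CommutativeMonoid)
import Algebra.Properties.AbelianGroup as AbelianGroupProperties
import Algebra.Properties.CommutativeSemigroup as CommutativeSemigroupProperties
open import Data.Integer as ℤ using (ℤ)
open import Data.List using (List; []; _∷_; map; filter; foldr; allFin)
open import Data.Nat as ℕ using (ℕ; zero; suc; _!)
import Data.Nat.Properties as ℕ
open import Data.Product using (_×_; _,_; proj₁; proj₂; ∃-syntax)
open import Data.Rational as ℚ using (ℚ; 0ℚ; 1ℚ)
import Data.Rational.Properties as ℚ
open import Data.Sum using (inj₁; inj₂)
open import Relation.Binary.PropositionalEquality
open import Relation.Nullary using (yes; no; contradiction)

-- Real numbers are Cauchy sequences of rationals.  No quotient is taken; the
-- equality of reals is _≃_ below.

Cauchy : (ℕ → ℚ) → Set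
Cauchy s = ∀ ε → 0ℚ ℚ.< ε →
  ∃[ N ] (∀ m n → N ℕ.≤ m → N ℕ.≤ n → ℚ.∣ s m ℚ.- s n ∣ ℚ.< ε)

record ℝ : Set where
  constructor mkℝ
  field
    approx : ℕ → ℚ
    cauchy : Cauchy approx

open ℝ public

module CauchyLemmas where

  open import Data.Rational hiding (ℚ; 0ℚ; 1ℚ)
  open ℚ.≤-Reasoning

  open AbelianGroupProperties ℚ.+-0-abelianGroup using (⁻¹-anti-homo‿-; xyx⁻¹≈y)
  module +-CS = CommutativeSemigroupProperties
    (CommutativeMonoid.commutativeSemigroup ℚ.+-0-commutativeMonoid)
  module *-CS = CommutativeSemigroupProperties
    (CommutativeMonoid.commutativeSemigroup ℚ.*-1-commutativeMonoid)

  q+[p-q]≡p : ∀ p q → q + (p - q) ≡ p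
  q+[p-q]≡p p q = trans (sym (ℚ.+-assoc q p (- q))) (xyx⁻¹≈y q p)

  [p+q]-[p′+q′] : ∀ p q p′ q′ → (p + q) - (p′ + q′) ≡ (p - p′) + (q - q′)
  [p+q]-[p′+q′] p q p′ q′ = trans (cong ((p + q) +_) (ℚ.neg-distrib-+ p′ q′))
    (+-CS.interchange p q (- p′) (- q′))

  p[q-r]≡pq-pr : ∀ p q r → p * (q - r) ≡ p * q - p * r
  p[q-r]≡pq-pr p q r = trans (ℚ.*-distribˡ-+ p q (- r))
    (cong (p * q +_) (sym (ℚ.neg-distribʳ-* p r)))

  pq-p′q′ : ∀ p q p′ q′ → (p * q) - (p′ * q′) ≡ p * (q - q′) + q′ * (p - p′)
  pq-p′q′ p q p′ q′ = begin-equality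
    p * q - p′ * q′
      ≡⟨ cong₂ _-_ (q+[p-q]≡p (p * q) (p * q′)) (ℚ.*-comm q′ p′) ⟨
    p * q′ + (p * q - p * q′) - q′ * p′
      ≡⟨ cong (_- q′ * p′) (ℚ.+-comm (p * q′) (p * q - p * q′)) ⟩
    (p * q - p * q′) + p * q′ - q′ * p′
      ≡⟨ ℚ.+-assoc (p * q - p * q′) (p * q′) (- (q′ * p′)) ⟩
    (p * q - p * q′) + (p * q′ - q′ * p′)
      ≡⟨ cong (λ r → (p * q - p * q′) + (r - q′ * p′)) (ℚ.*-comm p q′) ⟩
    (p * q - p * q′) + (q′ * p - q′ * p′)
      ≡⟨ cong₂ _+_ (p[q-r]≡pq-pr p q q′) (p[q-r]≡pq-pr q′ p p′) ⟨
    p * (q - q′) + q′ * (p - p′) ∎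

  cauchy-const : ∀ q → Cauchy (λ _ → q)
  cauchy-const q ε 0<ε = 0 , λ _ _ _ _ →
    subst (λ r → ∣ r ∣ < ε) (sym (ℚ.+-inverseʳ q)) 0<ε

  cauchy-lipschitz : ∀ (s t u : ℕ → ℚ) K .{{_ : Positive K}} →
    Cauchy s → Cauchy t →
    ∃[ N ] (∀ m n → N ℕ.≤ m → N ℕ.≤ n →
            ∣ u m - u n ∣ ≤ K * (∣ s m - s n ∣ + ∣ t m - t n ∣)) →
    Cauchy u
  cauchy-lipschitz s t u K cs ct (N , lip) ε 0<ε =
    N ℕ.⊔ (M₁ ℕ.⊔ M₂) , λ m n pm pn → begin-strict
      ∣ u m - u n ∣
        ≤⟨ lip m n (ℕ.m⊔n≤o⇒m≤o N _ pm) (ℕ.m⊔n≤o⇒m≤o N _ pn) ⟩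
      K * (∣ s m - s n ∣ + ∣ t m - t n ∣)
        <⟨ ℚ.*-monoʳ-<-pos K (ℚ.+-mono-<
             (close₁ m n (left m pm) (left n pn))
             (close₂ m n (right m pm) (right n pn))) ⟩
      K * (δ + δ)
        ≡⟨ cong (K *_) (ℚ.*-distribʳ-+ (1/ K * ε) ½ ½) ⟨
      K * (1ℚ * (1/ K * ε))
        ≡⟨ cong (K *_) (ℚ.*-identityˡ (1/ K * ε)) ⟩
      K * (1/ K * ε)
        ≡⟨ ℚ.*-assoc K (1/ K) ε ⟨
      (K * 1/ K) * ε
        ≡⟨ cong (_* ε) (ℚ.*-inverseʳ K) ⟩
      1ℚ * ε
        ≡⟨ ℚ.*-identityˡ ε ⟩
      ε ∎
    where
    instance
      K≢0 : NonZero K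
      K≢0 = ℚ.pos⇒nonZero K
    δ : ℚ
    δ = ½ * (1/ K * ε)
    0<δ : 0ℚ < δ
    0<δ = ℚ.positive⁻¹ δ
      {{ℚ.pos*pos⇒pos ½ (1/ K * ε)
        {{ℚ.pos*pos⇒pos (1/ K) {{ℚ.1/pos⇒pos K}} ε {{positive 0<ε}}}}}}
    M₁ M₂ : ℕ
    M₁ = proj₁ (cs δ 0<δ)
    M₂ = proj₁ (ct δ 0<δ)
    close₁ = proj₂ (cs δ 0<δ)
    close₂ = proj₂ (ct δ 0<δ)
    left : ∀ m → N ℕ.⊔ (M₁ ℕ.⊔ M₂) ℕ.≤ m → M₁ ℕ.≤ m
    left m p = ℕ.m⊔n≤o⇒m≤o M₁ M₂ (ℕ.m⊔n≤o⇒n≤o N _ p)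
    right : ∀ m → N ℕ.⊔ (M₁ ℕ.⊔ M₂) ℕ.≤ m → M₂ ℕ.≤ m
    right m p = ℕ.m⊔n≤o⇒n≤o M₁ M₂ (ℕ.m⊔n≤o⇒n≤o N _ p)

  p≤∣p∣ : ∀ p → p ≤ ∣ p ∣
  p≤∣p∣ p with ℚ.≤-total 0ℚ p
  ... | inj₁ 0≤p = ℚ.≤-reflexive (sym (ℚ.0≤p⇒∣p∣≡p 0≤p))
  ... | inj₂ p≤0 = ℚ.≤-trans p≤0 (ℚ.0≤∣p∣ p)

  ∣p-q∣≡∣q-p∣ : ∀ p q → ∣ p - q ∣ ≡ ∣ q - p ∣
  ∣p-q∣≡∣q-p∣ p q = trans (sym (ℚ.∣-p∣≡∣p∣ (p - q))) (cong ∣_∣ (⁻¹-anti-homo‿- p q))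

  p-q≤r⇒p≤q+r : ∀ p q {r} → p - q ≤ r → p ≤ q + r
  p-q≤r⇒p≤q+r p q {r} h = begin
    p           ≡⟨ q+[p-q]≡p p q ⟨
    q + (p - q) ≤⟨ ℚ.+-monoʳ-≤ q h ⟩
    q + r       ∎

  p≤q+r⇒p-q≤r : ∀ {p q r} → p ≤ q + r → p - q ≤ r
  p≤q+r⇒p-q≤r {p} {q} {r} h = begin
    p - q       ≤⟨ ℚ.+-monoˡ-≤ (- q) h ⟩
    (q + r) - q ≡⟨ xyx⁻¹≈y q r ⟩
    r           ∎

  ∣p-q∣≤r : ∀ {p q r} → p ≤ q + r → q ≤ p + r → ∣ p - q ∣ ≤ r
  ∣p-q∣≤r {p} {q} {r} h₁ h₂ with ℚ.∣p∣≡p∨∣p∣≡-p (p - q)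
  ... | inj₁ e = subst (_≤ r) (sym e) (p≤q+r⇒p-q≤r h₁)
  ... | inj₂ e = subst (_≤ r)
          (sym (trans e (⁻¹-anti-homo‿- p q)))
          (p≤q+r⇒p-q≤r h₂)

  +-lipschitz : ∀ p q p′ q′ →
    ∣ (p + q) - (p′ + q′) ∣ ≤ 1ℚ * (∣ p - p′ ∣ + ∣ q - q′ ∣)
  +-lipschitz p q p′ q′ = begin
    ∣ (p + q) - (p′ + q′) ∣
      ≡⟨ cong ∣_∣ ([p+q]-[p′+q′] p q p′ q′) ⟩
    ∣ (p - p′) + (q - q′) ∣            ≤⟨ ℚ.∣p+q∣≤∣p∣+∣q∣ (p - p′) (q - q′) ⟩
    ∣ p - p′ ∣ + ∣ q - q′ ∣            ≡⟨ ℚ.*-identityˡ _ ⟨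
    1ℚ * (∣ p - p′ ∣ + ∣ q - q′ ∣)     ∎

  neg-lipschitz : ∀ p p′ → ∣ (- p) - (- p′) ∣ ≤ 1ℚ * (∣ p - p′ ∣ + ∣ p - p′ ∣)
  neg-lipschitz p p′ = begin
    ∣ (- p) - (- p′) ∣
      ≡⟨ cong ∣_∣ (ℚ.neg-distrib-+ p (- p′)) ⟨
    ∣ - (p - p′) ∣                     ≡⟨ ℚ.∣-p∣≡∣p∣ (p - p′) ⟩
    ∣ p - p′ ∣                         ≡⟨ ℚ.+-identityʳ _ ⟨
    ∣ p - p′ ∣ + 0ℚ                    ≤⟨ ℚ.+-monoʳ-≤ ∣ p - p′ ∣ (ℚ.0≤∣p∣ (p - p′)) ⟩
    ∣ p - p′ ∣ + ∣ p - p′ ∣            ≡⟨ ℚ.*-identityˡ _ ⟨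
    1ℚ * (∣ p - p′ ∣ + ∣ p - p′ ∣)     ∎

  ⊔-near : ∀ p q p′ q′ → p ⊔ q ≤ (p′ ⊔ q′) + (∣ p - p′ ∣ + ∣ q - q′ ∣)
  ⊔-near p q p′ q′ = ℚ.⊔-lub {_} {p} {q}
    (ℚ.≤-trans (p-q≤r⇒p≤q+r p p′ (p≤∣p∣ (p - p′))) (ℚ.+-mono-≤ (ℚ.p≤p⊔q p′ q′) (begin
      ∣ p - p′ ∣              ≡⟨ ℚ.+-identityʳ _ ⟨
      ∣ p - p′ ∣ + 0ℚ         ≤⟨ ℚ.+-monoʳ-≤ ∣ p - p′ ∣ (ℚ.0≤∣p∣ (q - q′)) ⟩
      ∣ p - p′ ∣ + ∣ q - q′ ∣ ∎)))
    (ℚ.≤-trans (p-q≤r⇒p≤q+r q q′ (p≤∣p∣ (q - q′))) (ℚ.+-mono-≤ (ℚ.p≤q⊔p p′ q′) (begin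
      ∣ q - q′ ∣              ≡⟨ ℚ.+-identityˡ _ ⟨
      0ℚ + ∣ q - q′ ∣         ≤⟨ ℚ.+-monoˡ-≤ ∣ q - q′ ∣ (ℚ.0≤∣p∣ (p - p′)) ⟩
      ∣ p - p′ ∣ + ∣ q - q′ ∣ ∎)))

  ⊔-lipschitz : ∀ p q p′ q′ →
    ∣ (p ⊔ q) - (p′ ⊔ q′) ∣ ≤ 1ℚ * (∣ p - p′ ∣ + ∣ q - q′ ∣)
  ⊔-lipschitz p q p′ q′ = subst (∣ (p ⊔ q) - (p′ ⊔ q′) ∣ ≤_) (sym (ℚ.*-identityˡ _))
    (∣p-q∣≤r (⊔-near p q p′ q′)
      (subst₂ (λ d e → p′ ⊔ q′ ≤ (p ⊔ q) + (d + e))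
        (∣p-q∣≡∣q-p∣ p′ p) (∣p-q∣≡∣q-p∣ q′ q) (⊔-near p′ q′ p q)))

  bounded : ∀ s → Cauchy s →
    ∃[ B ] Positive B × ∃[ N ] (∀ n → N ℕ.≤ n → ∣ s n ∣ ≤ B)
  bounded s cs with cs 1ℚ (ℚ.positive⁻¹ 1ℚ)
  ... | N , close = ∣ s N ∣ + 1ℚ
      , ℚ.nonNeg+pos⇒pos ∣ s N ∣ {{ℚ.∣-∣-nonNeg (s N)}} 1ℚ
      , N , λ n N≤n → begin
          ∣ s n ∣                  ≡⟨ cong ∣_∣ (q+[p-q]≡p (s n) (s N)) ⟨
          ∣ s N + (s n - s N) ∣    ≤⟨ ℚ.∣p+q∣≤∣p∣+∣q∣ (s N) (s n - s N) ⟩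
          ∣ s N ∣ + ∣ s n - s N ∣  ≤⟨ ℚ.+-monoʳ-≤ ∣ s N ∣ (ℚ.<⇒≤ (close n N N≤n ℕ.≤-refl)) ⟩
          ∣ s N ∣ + 1ℚ             ∎

  *-lipschitz : ∀ p q p′ q′ {A B} → Positive A → Positive B →
    ∣ p ∣ ≤ A → ∣ q′ ∣ ≤ B →
    ∣ (p * q) - (p′ * q′) ∣ ≤ (A + B) * (∣ p - p′ ∣ + ∣ q - q′ ∣)
  *-lipschitz p q p′ q′ {A} {B} A>0 B>0 p≤A q′≤B = begin
    ∣ (p * q) - (p′ * q′) ∣
      ≡⟨ cong ∣_∣ (pq-p′q′ p q p′ q′) ⟩
    ∣ p * (q - q′) + q′ * (p - p′) ∣
      ≤⟨ ℚ.∣p+q∣≤∣p∣+∣q∣ (p * (q - q′)) (q′ * (p - p′)) ⟩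
    ∣ p * (q - q′) ∣ + ∣ q′ * (p - p′) ∣
      ≡⟨ cong₂ _+_ (ℚ.∣p*q∣≡∣p∣*∣q∣ p (q - q′)) (ℚ.∣p*q∣≡∣p∣*∣q∣ q′ (p - p′)) ⟩
    ∣ p ∣ * e + ∣ q′ ∣ * d
      ≤⟨ ℚ.+-mono-≤ (ℚ.*-monoʳ-≤-nonNeg e {{ℚ.∣-∣-nonNeg (q - q′)}} p≤A)
                    (ℚ.*-monoʳ-≤-nonNeg d {{ℚ.∣-∣-nonNeg (p - p′)}} q′≤B) ⟩
    A * e + B * d
      ≡⟨ ℚ.+-identityʳ _ ⟨
    (A * e + B * d) + 0ℚ
      ≤⟨ ℚ.+-monoʳ-≤ (A * e + B * d) 0≤Ad+Be ⟩
    (A * e + B * d) + (A * d + B * e)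
      ≡⟨ +-CS.interchange (A * e) (B * d) (A * d) (B * e) ⟩
    (A * e + A * d) + (B * d + B * e)
      ≡⟨ cong₂ _+_ (trans (ℚ.+-comm (A * e) (A * d)) (sym (ℚ.*-distribˡ-+ A d e)))
                   (sym (ℚ.*-distribˡ-+ B d e)) ⟩
    A * (d + e) + B * (d + e)
      ≡⟨ ℚ.*-distribʳ-+ (d + e) A B ⟨
    (A + B) * (d + e) ∎
    where
    d e : ℚ
    d = ∣ p - p′ ∣
    e = ∣ q - q′ ∣
    instance
      A≥0 : NonNegative A
      A≥0 = ℚ.pos⇒nonNeg A {{A>0}}
      B≥0 : NonNegative B
      B≥0 = ℚ.pos⇒nonNeg B {{B>0}}
      d≥0 : NonNegative d
      d≥0 = ℚ.∣-∣-nonNeg (p - p′)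
      e≥0 : NonNegative e
      e≥0 = ℚ.∣-∣-nonNeg (q - q′)
    0≤Ad+Be : 0ℚ ≤ A * d + B * e
    0≤Ad+Be = ℚ.nonNegative⁻¹ (A * d + B * e)
      {{ℚ.nonNeg+nonNeg⇒nonNeg (A * d) {{ℚ.nonNeg*nonNeg⇒nonNeg A d}}
                               (B * e) {{ℚ.nonNeg*nonNeg⇒nonNeg B e}}}}

  inv : ℚ → ℚ
  inv q with q ℚ.≟ 0ℚ
  ... | yes _  = 0ℚ
  ... | no q≢0 = (1/ q) {{≢-nonZero q≢0}}

  *-inv : ∀ {q} → 0ℚ < q → q * inv q ≡ 1ℚ
  *-inv {q} 0<q with q ℚ.≟ 0ℚ
  ... | yes q≡0 = contradiction (sym q≡0) (ℚ.<⇒≢ 0<q)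
  ... | no q≢0  = ℚ.*-inverseʳ q {{≢-nonZero q≢0}}

  inv-pos : ∀ {q} → 0ℚ < q → Positive (inv q)
  inv-pos {q} 0<q with q ℚ.≟ 0ℚ
  ... | yes q≡0 = contradiction (sym q≡0) (ℚ.<⇒≢ 0<q)
  ... | no q≢0  = ℚ.1/pos⇒pos q {{positive 0<q}}

  inv-anti : ∀ {δ p} → 0ℚ < δ → δ ≤ p → inv p ≤ inv δ
  inv-anti {δ} {p} 0<δ δ≤p = begin
    inv p                 ≡⟨ ℚ.*-identityʳ (inv p) ⟨
    inv p * 1ℚ            ≡⟨ cong (inv p *_) (*-inv 0<δ) ⟨
    inv p * (δ * inv δ)   ≤⟨ ℚ.*-monoˡ-≤-nonNeg (inv p)
                               (ℚ.*-monoʳ-≤-nonNeg (inv δ) δ≤p) ⟩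
    inv p * (p * inv δ)   ≡⟨ *-CS.x∙yz≈yx∙z (inv p) p (inv δ) ⟩
    (p * inv p) * inv δ   ≡⟨ cong (_* inv δ) (*-inv 0<p) ⟩
    1ℚ * inv δ            ≡⟨ ℚ.*-identityˡ (inv δ) ⟩
    inv δ                 ∎
    where
    0<p : 0ℚ < p
    0<p = ℚ.<-≤-trans 0<δ δ≤p
    instance
      ip≥0 : NonNegative (inv p)
      ip≥0 = ℚ.pos⇒nonNeg (inv p) {{inv-pos 0<p}}
      iδ≥0 : NonNegative (inv δ)
      iδ≥0 = ℚ.pos⇒nonNeg (inv δ) {{inv-pos 0<δ}}

  inv-lipschitz : ∀ {δ p q} → 0ℚ < δ → δ ≤ p → δ ≤ q →
    ∣ inv p - inv q ∣ ≤ (inv δ * inv δ) * (∣ p - q ∣ + ∣ p - q ∣)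
  inv-lipschitz {δ} {p} {q} 0<δ δ≤p δ≤q = begin
    ∣ i - j ∣
      ≡⟨ cong₂ (λ a b → ∣ a - b ∣) (ℚ.*-identityʳ i) (ℚ.*-identityʳ j) ⟨
    ∣ i * 1ℚ - j * 1ℚ ∣
      ≡⟨ cong₂ (λ a b → ∣ i * a - j * b ∣) (*-inv 0<q) (*-inv 0<p) ⟨
    ∣ i * (q * j) - j * (p * i) ∣
      ≡⟨ cong ∣_∣ (cong₂ _-_
           (*-CS.x∙yz≈xz∙y i q j) (*-CS.x∙yz≈zx∙y j p i)) ⟩
    ∣ (i * j) * q - (i * j) * p ∣
      ≡⟨ cong ∣_∣ (p[q-r]≡pq-pr (i * j) q p) ⟨
    ∣ (i * j) * (q - p) ∣
      ≡⟨ ℚ.∣p*q∣≡∣p∣*∣q∣ (i * j) (q - p) ⟩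
    ∣ i * j ∣ * ∣ q - p ∣
      ≡⟨ cong₂ _*_ (ℚ.0≤p⇒∣p∣≡p (ℚ.nonNegative⁻¹ (i * j) {{ℚ.nonNeg*nonNeg⇒nonNeg i j}}))
                   (∣p-q∣≡∣q-p∣ q p) ⟩
    (i * j) * d
      ≤⟨ ℚ.*-monoʳ-≤-nonNeg d (ℚ.*-monoˡ-≤-nonNeg i (inv-anti 0<δ δ≤q)) ⟩
    (i * κ) * d
      ≤⟨ ℚ.*-monoʳ-≤-nonNeg d (ℚ.*-monoʳ-≤-nonNeg κ (inv-anti 0<δ δ≤p)) ⟩
    (κ * κ) * d
      ≡⟨ cong ((κ * κ) *_) (ℚ.+-identityʳ d) ⟨
    (κ * κ) * (d + 0ℚ)
      ≤⟨ ℚ.*-monoˡ-≤-nonNeg (κ * κ) {{ℚ.nonNeg*nonNeg⇒nonNeg κ κ}}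
           (ℚ.+-monoʳ-≤ d (ℚ.0≤∣p∣ (p - q))) ⟩
    (κ * κ) * (d + d) ∎
    where
    i j κ d : ℚ
    i = inv p
    j = inv q
    κ = inv δ
    d = ∣ p - q ∣
    0<p : 0ℚ < p
    0<p = ℚ.<-≤-trans 0<δ δ≤p
    0<q : 0ℚ < q
    0<q = ℚ.<-≤-trans 0<δ δ≤q
    instance
      i≥0 : NonNegative i
      i≥0 = ℚ.pos⇒nonNeg i {{inv-pos 0<p}}
      j≥0 : NonNegative j
      j≥0 = ℚ.pos⇒nonNeg j {{inv-pos 0<q}}
      κ≥0 : NonNegative κ
      κ≥0 = ℚ.pos⇒nonNeg κ {{inv-pos 0<δ}}
      d≥0 : NonNegative d
      d≥0 = ℚ.∣-∣-nonNeg (p - q)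

open CauchyLemmas

open import Data.Fin using (Fin)
open import Data.Fin.Subset using (Subset; _∪_; _─_; ⁅_⁆; ∣_∣)
open import Data.Fin.Subset.Properties using (_∈?_)

infix  4 _≤_ _<_ _≃_
infixl 6 _+_ _-_ _⊔_
infixl 7 _*_ _÷_[_]
infix  8 -_
infixr 8 _^_

_≤_ : ℝ → ℝ → Set
x ≤ y = ∀ ε → 0ℚ ℚ.< ε →
  ∃[ N ] (∀ n → N ℕ.≤ n → approx x n ℚ.≤ approx y n ℚ.+ ε)

_<_ : ℝ → ℝ → Set
x < y = ∃[ ε ] 0ℚ ℚ.< ε ×
  ∃[ N ] (∀ n → N ℕ.≤ n → approx x n ℚ.+ ε ℚ.≤ approx y n)

_≃_ : ℝ → ℝ → Set
x ≃ y = x ≤ y × y ≤ x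

fromℚ : ℚ → ℝ
fromℚ q = mkℝ (λ _ → q) (cauchy-const q)

fromℤ : ℤ → ℝ
fromℤ z = fromℚ (z ℚ./ 1)

fromℕ : ℕ → ℝ
fromℕ n = fromℤ (ℤ.+ n)

0ℝ 1ℝ : ℝ
0ℝ = fromℚ 0ℚ
1ℝ = fromℚ 1ℚ

_+_ : ℝ → ℝ → ℝ
x + y = mkℝ (λ n → approx x n ℚ.+ approx y n)
  (cauchy-lipschitz (approx x) (approx y) (λ n → approx x n ℚ.+ approx y n)
    1ℚ (cauchy x) (cauchy y) (0 , λ m n _ _ →
    +-lipschitz (approx x m) (approx y m) (approx x n) (approx y n)))

-_ : ℝ → ℝ
- x = mkℝ (λ n → ℚ.- approx x n)
  (cauchy-lipschitz (approx x) (approx x) (λ n → ℚ.- approx x n)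
    1ℚ (cauchy x) (cauchy x) (0 , λ m n _ _ →
    neg-lipschitz (approx x m) (approx x n)))

_-_ : ℝ → ℝ → ℝ
x - y = x + (- y)

_⊔_ : ℝ → ℝ → ℝ
x ⊔ y = mkℝ (λ n → approx x n ℚ.⊔ approx y n)
  (cauchy-lipschitz (approx x) (approx y) (λ n → approx x n ℚ.⊔ approx y n)
    1ℚ (cauchy x) (cauchy y) (0 , λ m n _ _ →
    ⊔-lipschitz (approx x m) (approx y m) (approx x n) (approx y n)))

abs : ℝ → ℝ
abs x = x ⊔ (- x)

*-cauchy : ∀ s t → Cauchy s → Cauchy t → Cauchy (λ n → s n ℚ.* t n)
*-cauchy s t cs ct with bounded s cs | bounded t ct
... | A , A>0 , M , s≤A | B , B>0 , N , t≤B =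
  cauchy-lipschitz s t (λ n → s n ℚ.* t n) (A ℚ.+ B)
    {{ℚ.nonNeg+pos⇒pos A {{ℚ.pos⇒nonNeg A {{A>0}}}} B {{B>0}}}}
    cs ct (M ℕ.⊔ N , λ m n pm pn →
      *-lipschitz (s m) (t m) (s n) (t n) A>0 B>0
        (s≤A m (ℕ.m⊔n≤o⇒m≤o M N pm)) (t≤B n (ℕ.m⊔n≤o⇒n≤o M N pn)))

_*_ : ℝ → ℝ → ℝ
x * y = mkℝ (λ n → approx x n ℚ.* approx y n)
  (*-cauchy (approx x) (approx y) (cauchy x) (cauchy y))

-- The rational inverse inv has inv 0 = 0, which is irrelevant to the limit
-- since the approximations of a positive real are eventually bounded away
-- from 0.
inv-cauchy : ∀ y → 0ℝ < y → Cauchy (λ n → inv (approx y n))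
inv-cauchy y (δ , 0<δ , N , δ≤y) =
  cauchy-lipschitz (approx y) (approx y) (λ n → inv (approx y n)) (inv δ ℚ.* inv δ)
    {{ℚ.pos*pos⇒pos (inv δ) {{inv-pos 0<δ}} (inv δ) {{inv-pos 0<δ}}}}
    (cauchy y) (cauchy y)
    (N , λ m n pm pn → inv-lipschitz 0<δ (bound m pm) (bound n pn))
  where
  bound : ∀ n → N ℕ.≤ n → δ ℚ.≤ approx y n
  bound n p = subst (ℚ._≤ approx y n) (ℚ.+-identityˡ δ) (δ≤y n p)

_÷_[_] : ℝ → (y : ℝ) → 0ℝ < y → ℝ
x ÷ y [ 0<y ] = x * mkℝ (λ n → inv (approx y n)) (inv-cauchy y 0<y)

_^_ : ℝ → ℕ → ℝ
x ^ zero  = 1ℝ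
x ^ suc j = x * x ^ j

_⟶_ : (ℕ → ℝ) → ℝ → Set
s ⟶ y = ∀ ε → 0ℝ < ε → ∃[ N ] (∀ m → N ℕ.≤ m → abs (s m - y) < ε)

1/_! : ℕ → ℝ
1/ j ! = fromℚ ((ℤ.+ 1) ℚ./ (j !))
  where instance _ = j ℕ.!≢0

-- expSum x m = Σ_{j<m} x^j / j!
expSum : ℝ → ℕ → ℝ
expSum x zero    = 0ℝ
expSum x (suc m) = expSum x m + x ^ m * 1/ m !

-- exp x = y, i.e. the exponential series of x converges to y
IsExp : ℝ → ℝ → Set
IsExp x y = expSum x ⟶ y

-- ln y = x
IsLn : ℝ → ℝ → Set
IsLn y x = IsExp x y

-- ⌈ x ⌉ = z.  The ceiling is a relation since it is not a computable function
-- of a Cauchy sequence.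
IsCeiling : ℝ → ℤ → Set
IsCeiling x z = fromℤ z - 1ℝ < x × x ≤ fromℤ z

-- Only the value on nonempty lists is meaningful.
maximum : List ℝ → ℝ
maximum []       = 0ℝ
maximum (x ∷ xs) = foldr _⊔_ x xs

elements : ∀ {n} → Subset n → List (Fin n)
elements S = filter (_∈? S) (allFin _)

max[_]_ : ∀ {n} → Subset n → (Fin n → ℝ) → ℝ
max[ S ] g = maximum (map g (elements S))

module _ {n : ℕ} (f : Subset n → ℝ) where

  NonNegative : Set
  NonNegative = ∀ S → 0ℝ ≤ f S

  NonIncreasing : Set
  NonIncreasing = ∀ S T → f (S ∪ T) ≤ f S

  -- For T ⊆ S the right-hand side is 0, because of the factor ∣ T ─ S ∣.
  WeaklySupermodular : ℝ → Set
  WeaklySupermodular α = ∀ S T →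
    f S - f (S ∪ T) ≤
      α * fromℕ ∣ T ─ S ∣ * (max[ T ─ S ] λ i → f S - f (S ∪ ⁅ i ⁆))

  IsOptimal : ℕ → Subset n → Set
  IsOptimal k S = ∣ S ∣ ℕ.≤ k × (∀ T → ∣ T ∣ ℕ.≤ k → f S ≤ f T)

  IsArgmin : Subset n → Fin n → Set
  IsArgmin S i = ∀ j → f (S ∪ ⁅ i ⁆) ≤ f (S ∪ ⁅ j ⁆)

  -- Greedy S₀ t S: some run of the greedy algorithm from S₀ has S_t = S.
  data Greedy (S₀ : Subset n) : ℕ → Subset n → Set where
    start : Greedy S₀ 0 S₀
    step  : ∀ {t S} → Greedy S₀ t S → ∀ i → IsArgmin S i →
            Greedy S₀ (suc t) (S ∪ ⁅ i ⁆)

{-# OPTIONS --safe #-}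
-- Write K = αk and x = 1/K ∈ [0,1].  Weak supermodularity with T = S* and the
-- choice of i give f S - f S* ≤ K (f S - f (S ∪ {i})), so each step multiplies
-- the gap f S - f S* by at most 1 - x, and after τ steps the gap is at most
-- (1 - x)^τ f S₀ = (1 - x)^τ e^L E.  It remains to see (1 - x)^τ e^L ≤ 1, where
-- L ≤ τ x.  The tangent inequality for the partial sums e_m of the exponential
-- series, e_m (x + y) ≤ e_m y + x e_m (x + y) for x, y ≥ 0, yields
-- (1 - x)^τ e_m (τ x) ≤ 1, which settles L ≥ 0.  If L ≤ 0 then -1 ≤ L, since τ ≥ 0
-- is the ceiling of K L, and e_m L ≤ 1 as the terms alternate and decrease.
module Submission where

open import Data.Bool using (true; false)
open import Data.Fin.Subset using (Subset; _∪_; _─_; ⁅_⁆; ∣_∣)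
open import Data.Fin.Subset.Properties using (∪-comm; ∣⁅x⁆∣≡1; ∣p─q∣≤∣p∣)
open import Data.Integer as ℤ using (ℤ)
import Data.Integer.Properties as ℤ
open import Data.List using ([]; _∷_; map; foldr)
open import Data.Nat as ℕ using (ℕ; zero; suc; _!)
import Data.Nat.Properties as ℕ
open import Data.Product using (_×_; _,_; proj₁; proj₂; ∃-syntax)
open import Data.Rational as ℚ using (ℚ; 0ℚ; 1ℚ; ½)
import Data.Rational.Properties as ℚ
open import Data.Rational.Solver using (module +-*-Solver)
open import Data.Rational.Unnormalised as ℚᵘ using (mkℚᵘ; *≡*)
import Data.Rational.Unnormalised.Properties as ℚᵘ
open import Data.Sum using (inj₁; inj₂)
open import Data.Vec using ([]; _∷_)
open import Level using (0ℓ)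
open import Relation.Binary.Bundles using (Preorder)
open import Relation.Binary.PropositionalEquality
  using (_≡_; refl; sym; trans; cong; subst; subst₂; module ≡-Reasoning)
import Relation.Binary.Reasoning.Preorder as PreorderReasoning
open import Relation.Nullary using (¬_; Dec; yes; no; contradiction)
open import Defs
open CauchyLemmas
open +-*-Solver using (solve; _:=_; _:+_; _:*_; _:-_; :-_; con)

-- The order on Cauchy reals and its compatibility with the ring operations.

infix 4 _≗_

-- Finer than `_≃_`. Ring operations act termwise on approximations, so a ring identity between
-- reals is a rational identity at each index, within reach of the rational solver. As the equality
-- of `≤-preorder` it justifies the `≈` steps of all chains of inequalities below.
_≗_ : ℝ → ℝ → Set
x ≗ y = ∀ n → approx x n ≡ approx y n

½ε+½ε : ∀ ε → ½ ℚ.* ε ℚ.+ ½ ℚ.* ε ≡ ε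
½ε+½ε = solve 1 (λ e → con ½ :* e :+ con ½ :* e := e) refl

*-pos : ∀ {p q} → 0ℚ ℚ.< p → 0ℚ ℚ.< q → 0ℚ ℚ.< p ℚ.* q
*-pos {p} {q} 0<p 0<q = ℚ.positive⁻¹ (p ℚ.* q)
  {{ℚ.pos*pos⇒pos p {{ℚ.positive 0<p}} q {{ℚ.positive 0<q}}}}

p≤p+ε : ∀ p {ε} → 0ℚ ℚ.< ε → p ℚ.≤ p ℚ.+ ε
p≤p+ε p {ε} 0<ε = subst (ℚ._≤ p ℚ.+ ε) (ℚ.+-identityʳ p) (ℚ.+-monoʳ-≤ p (ℚ.<⇒≤ 0<ε))

0<½*ε : ∀ {ε} → 0ℚ ℚ.< ε → 0ℚ ℚ.< ½ ℚ.* ε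
0<½*ε = *-pos (ℚ.positive⁻¹ ½)

eventually-≤⇒≤ : ∀ x y N → (∀ n → N ℕ.≤ n → approx x n ℚ.≤ approx y n) → x ≤ y
eventually-≤⇒≤ x y N x≤y ε 0<ε = N , λ n N≤n →
  ℚ.≤-trans (x≤y n N≤n) (p≤p+ε (approx y n) 0<ε)

≗⇒≤ : ∀ x y → x ≗ y → x ≤ y
≗⇒≤ x y x≗y = eventually-≤⇒≤ x y 0 λ n _ → ℚ.≤-reflexive (x≗y n)

≤-trans : ∀ x y z → x ≤ y → y ≤ z → x ≤ z
≤-trans x y z x≤y y≤z ε 0<ε =
  let M , x≤y+½ε = x≤y (½ ℚ.* ε) (0<½*ε 0<ε)
      N , y≤z+½ε = y≤z (½ ℚ.* ε) (0<½*ε 0<ε)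
  in M ℕ.⊔ N , λ n p → begin
    approx x n
      ≤⟨ x≤y+½ε n (ℕ.m⊔n≤o⇒m≤o M N p) ⟩
    approx y n ℚ.+ ½ ℚ.* ε
      ≤⟨ ℚ.+-monoˡ-≤ _ (y≤z+½ε n (ℕ.m⊔n≤o⇒n≤o M N p)) ⟩
    approx z n ℚ.+ ½ ℚ.* ε ℚ.+ ½ ℚ.* ε
      ≡⟨ ℚ.+-assoc (approx z n) _ _ ⟩
    approx z n ℚ.+ (½ ℚ.* ε ℚ.+ ½ ℚ.* ε)
      ≡⟨ cong (approx z n ℚ.+_) (½ε+½ε ε) ⟩
    approx z n ℚ.+ ε ∎
  where open ℚ.≤-Reasoning

≤-preorder : Preorder 0ℓ 0ℓ 0ℓ
≤-preorder = record
  { _≈_ = _≗_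
  ; _≲_ = _≤_
  ; isPreorder = record
    { isEquivalence = record
      { refl  = λ _ → refl
      ; sym   = λ x≗y n → sym (x≗y n)
      ; trans = λ x≗y y≗z n → trans (x≗y n) (y≗z n)
      }
    ; reflexive     = λ {x} {y} → ≗⇒≤ x y
    ; trans         = λ {x} {y} {z} → ≤-trans x y z
    }
  }

module ≤-Reasoning = PreorderReasoning ≤-preorder

≤-refl : ∀ x → x ≤ x
≤-refl x = ≗⇒≤ x x λ _ → refl

<⇒≤ : ∀ x y → x < y → x ≤ y
<⇒≤ x y (ε , 0<ε , N , x+ε≤y) = eventually-≤⇒≤ x y N λ n N≤n →
  ℚ.≤-trans (p≤p+ε (approx x n) 0<ε) (x+ε≤y n N≤n)

fromℚ-mono-≤ : ∀ {p q} → p ℚ.≤ q → fromℚ p ≤ fromℚ q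
fromℚ-mono-≤ {p} {q} p≤q = eventually-≤⇒≤ (fromℚ p) (fromℚ q) 0 λ _ _ → p≤q

+-monoˡ-≤ : ∀ z x y → x ≤ y → x + z ≤ y + z
+-monoˡ-≤ z x y x≤y ε 0<ε =
  let N , x≤y+ε = x≤y ε 0<ε
  in N , λ n N≤n → ℚ.≤-trans (ℚ.+-monoˡ-≤ (approx z n) (x≤y+ε n N≤n))
       (ℚ.≤-reflexive (+-CS.xy∙z≈xz∙y (approx y n) ε (approx z n)))

+-monoʳ-≤ : ∀ z x y → x ≤ y → z + x ≤ z + y
+-monoʳ-≤ z x y x≤y = begin
  z + x ≈⟨ (λ n → ℚ.+-comm (approx z n) (approx x n)) ⟩
  x + z ≲⟨ +-monoˡ-≤ z x y x≤y ⟩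
  y + z ≈⟨ (λ n → ℚ.+-comm (approx y n) (approx z n)) ⟩
  z + y ∎
  where open ≤-Reasoning

+-mono-≤ : ∀ u v x y → u ≤ v → x ≤ y → u + x ≤ v + y
+-mono-≤ u v x y u≤v x≤y =
  ≤-trans (u + x) (v + x) (v + y) (+-monoˡ-≤ x u v u≤v) (+-monoʳ-≤ v x y x≤y)

x≤y⇒0≤y-x : ∀ x y → x ≤ y → 0ℝ ≤ y - x
x≤y⇒0≤y-x x y x≤y = begin
  0ℝ    ≈⟨ (λ n → ℚ.+-inverseʳ (approx x n)) ⟨
  x - x ≲⟨ +-monoˡ-≤ (- x) x y x≤y ⟩
  y - x ∎
  where open ≤-Reasoning

0≤y-x⇒x≤y : ∀ x y → 0ℝ ≤ y - x → x ≤ y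
0≤y-x⇒x≤y x y 0≤y-x = begin
  x           ≈⟨ (λ n → ℚ.+-identityʳ (approx x n)) ⟨
  x + 0ℝ      ≲⟨ +-monoʳ-≤ x 0ℝ (y - x) 0≤y-x ⟩
  x + (y - x) ≈⟨ (λ n → q+[p-q]≡p (approx y n) (approx x n)) ⟩
  y           ∎
  where open ≤-Reasoning

neg-antimono-≤ : ∀ x y → x ≤ y → - y ≤ - x
neg-antimono-≤ x y x≤y = 0≤y-x⇒x≤y (- y) (- x) (begin
  0ℝ           ≲⟨ x≤y⇒0≤y-x x y x≤y ⟩
  y - x        ≈⟨ (λ n → solve 2 (λ x y → y :- x := (:- x) :- (:- y)) refl
                    (approx x n) (approx y n)) ⟩
  - x - (- y)  ∎)
  where open ≤-Reasoning

-‿monoʳ-≤ : ∀ z x y → x ≤ y → z - y ≤ z - x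
-‿monoʳ-≤ z x y x≤y = +-monoʳ-≤ z (- y) (- x) (neg-antimono-≤ x y x≤y)

-- For N beyond a Cauchy modulus of z, the rational inequality z_N ≤ ½ε is
-- decidable, and its failure separates 0 from z.
0≮z⇒z≤0 : ∀ z → ¬ (0ℝ < z) → z ≤ 0ℝ
0≮z⇒z≤0 z 0≮z ε 0<ε = decide (approx z N ℚ.≤? η)
  where
  open ℚ.≤-Reasoning
  η δ : ℚ
  η = ½ ℚ.* ε
  δ = ½ ℚ.* η
  0<δ : 0ℚ ℚ.< δ
  0<δ = 0<½*ε (0<½*ε 0<ε)
  N : ℕ
  N = proj₁ (cauchy z δ 0<δ)
  near : ∀ m n → N ℕ.≤ m → N ℕ.≤ n → approx z m ℚ.≤ approx z n ℚ.+ δ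
  near m n N≤m N≤n = p-q≤r⇒p≤q+r (approx z m) (approx z n)
    (ℚ.≤-trans (p≤∣p∣ (approx z m ℚ.- approx z n))
               (ℚ.<⇒≤ (proj₂ (cauchy z δ 0<δ) m n N≤m N≤n)))
  decide : Dec (approx z N ℚ.≤ η) →
    ∃[ N ] (∀ n → N ℕ.≤ n → approx z n ℚ.≤ 0ℚ ℚ.+ ε)
  decide (yes z≤η) = N , λ n N≤n → begin
    approx z n           ≤⟨ near n N N≤n ℕ.≤-refl ⟩
    approx z N ℚ.+ δ     ≤⟨ ℚ.+-mono-≤ z≤η (p≤p+ε δ 0<δ) ⟩
    η ℚ.+ (δ ℚ.+ δ)      ≡⟨ cong (η ℚ.+_) (½ε+½ε η) ⟩
    η ℚ.+ η              ≡⟨ ½ε+½ε ε ⟩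
    ε                    ≡⟨ ℚ.+-identityˡ ε ⟨
    0ℚ ℚ.+ ε             ∎
  -- Here `approx z N` exceeds `η` = 2`δ`, and the later terms differ from it by at most `δ`. They
  -- all stay above `δ`, which makes `z` positive.
  decide (no z≰η) = contradiction (δ , 0<δ , N , λ n N≤n → begin
    0ℚ ℚ.+ δ             ≡⟨ ℚ.+-identityˡ δ ⟩
    δ                    ≡⟨ q+[p-q]≡p δ δ ⟨
    δ ℚ.+ (δ ℚ.- δ)      ≡⟨ ℚ.+-assoc δ δ (ℚ.- δ) ⟨
    δ ℚ.+ δ ℚ.- δ        ≡⟨ cong (ℚ._- δ) (½ε+½ε η) ⟩
    η ℚ.- δ              ≤⟨ p≤q+r⇒p-q≤r (begin
      η                    ≤⟨ ℚ.<⇒≤ (ℚ.≰⇒> z≰η) ⟩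
      approx z N           ≤⟨ near N n ℕ.≤-refl N≤n ⟩
      approx z n ℚ.+ δ     ≡⟨ ℚ.+-comm (approx z n) δ ⟩
      δ ℚ.+ approx z n     ∎) ⟩
    approx z n           ∎) 0≮z

0<x-y⇒y<x : ∀ x y → 0ℝ < x - y → y < x
0<x-y⇒y<x x y (ε , 0<ε , N , ε≤x-y) = ε , 0<ε , N , λ n N≤n → begin
  approx y n ℚ.+ ε
    ≡⟨ cong (approx y n ℚ.+_) (ℚ.+-identityˡ ε) ⟨
  approx y n ℚ.+ (0ℚ ℚ.+ ε)
    ≤⟨ ℚ.+-monoʳ-≤ (approx y n) (ε≤x-y n N≤n) ⟩
  approx y n ℚ.+ (approx x n ℚ.- approx y n)
    ≡⟨ q+[p-q]≡p (approx x n) (approx y n) ⟩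
  approx x n ∎
  where open ℚ.≤-Reasoning

≮⇒≥ : ∀ x y → ¬ (y < x) → x ≤ y
≮⇒≥ x y y≮x = begin
  x            ≈⟨ (λ n → q+[p-q]≡p (approx x n) (approx y n)) ⟨
  y + (x - y)  ≲⟨ +-monoʳ-≤ y (x - y) 0ℝ
                    (0≮z⇒z≤0 (x - y) (λ 0<x-y → y≮x (0<x-y⇒y<x x y 0<x-y))) ⟩
  y + 0ℝ       ≈⟨ (λ n → ℚ.+-identityʳ (approx y n)) ⟩
  y            ∎
  where open ≤-Reasoning

≤⇒≯ : ∀ x y → x ≤ y → ¬ (y < x)
≤⇒≯ x y x≤y (ε , 0<ε , N , y+ε≤x) =
  let M , x≤y+½ε = x≤y (½ ℚ.* ε) (0<½*ε 0<ε)
      -- At a common index beyond both moduli, y + ε ≤ x ≤ y + ε/2, which is absurd.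
      n = M ℕ.⊔ N
  in ℚ.<-irrefl refl (begin-strict
    approx y n ℚ.+ ε
      ≤⟨ y+ε≤x n (ℕ.m≤n⊔m M N) ⟩
    approx x n
      ≤⟨ x≤y+½ε n (ℕ.m≤m⊔n M N) ⟩
    approx y n ℚ.+ ½ ℚ.* ε
      <⟨ ℚ.+-monoʳ-< (approx y n) (begin-strict
           ½ ℚ.* ε              ≡⟨ ℚ.+-identityʳ _ ⟨
           ½ ℚ.* ε ℚ.+ 0ℚ       <⟨ ℚ.+-monoʳ-< (½ ℚ.* ε) (0<½*ε 0<ε) ⟩
           ½ ℚ.* ε ℚ.+ ½ ℚ.* ε  ≡⟨ ½ε+½ε ε ⟩
           ε                    ∎) ⟩
    approx y n ℚ.+ ε ∎)
  where open ℚ.≤-Reasoning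

-- _≤_ is stable, so that an inequality may be proved by cases on the
-- (undecidable) order of two reals.
by-cases : ∀ x y u v → (x ≤ y → u ≤ v) → (y ≤ x → u ≤ v) → u ≤ v
by-cases x y u v x≤y⇒u≤v y≤x⇒u≤v = ≮⇒≥ u v λ v<u →
  ≤⇒≯ u v (y≤x⇒u≤v (≮⇒≥ y x λ x<y → ≤⇒≯ u v (x≤y⇒u≤v (<⇒≤ x y x<y)) v<u)) v<u

-- With a, b ≥ -δ and a + b + δ ≤ C eventually, ab = (a + δ)(b + δ) - δ(a + b + δ) ≥ -δC.
*-nonNeg : ∀ x y → 0ℝ ≤ x → 0ℝ ≤ y → 0ℝ ≤ x * y
*-nonNeg x y 0≤x 0≤y ε 0<ε with bounded (approx x) (cauchy x) | bounded (approx y) (cauchy y)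
... | A , A>0 , M , x≤A | B , B>0 , N , y≤B =
  M ℕ.⊔ N ℕ.⊔ (proj₁ (0≤x δ 0<δ) ℕ.⊔ proj₁ (0≤y δ 0<δ)) , λ n p →
  let a = approx x n
      b = approx y n
      p₁ = ℕ.m⊔n≤o⇒m≤o (M ℕ.⊔ N) _ p
      p₂ = ℕ.m⊔n≤o⇒n≤o (M ℕ.⊔ N) _ p
      0≤a+δ = proj₂ (0≤x δ 0<δ) n (ℕ.m⊔n≤o⇒m≤o (proj₁ (0≤x δ 0<δ)) _ p₂)
      0≤b+δ = proj₂ (0≤y δ 0<δ) n (ℕ.m⊔n≤o⇒n≤o (proj₁ (0≤x δ 0<δ)) _ p₂)
  in begin
  0ℚ
    ≤⟨ ℚ.nonNegative⁻¹ _ {{ℚ.nonNeg*nonNeg⇒nonNeg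
         (a ℚ.+ δ) {{ℚ.nonNegative 0≤a+δ}} (b ℚ.+ δ) {{ℚ.nonNegative 0≤b+δ}}}} ⟩
  (a ℚ.+ δ) ℚ.* (b ℚ.+ δ)
    ≡⟨ expand a b δ ⟩
  a ℚ.* b ℚ.+ δ ℚ.* (a ℚ.+ b ℚ.+ δ)
    ≤⟨ ℚ.+-monoʳ-≤ (a ℚ.* b) (ℚ.*-monoˡ-≤-nonNeg δ {{ℚ.nonNegative (ℚ.<⇒≤ 0<δ)}}
         (ℚ.+-mono-≤ (ℚ.+-mono-≤
           (ℚ.≤-trans (p≤∣p∣ a) (x≤A n (ℕ.m⊔n≤o⇒m≤o M N p₁)))
           (ℚ.≤-trans (p≤∣p∣ b) (y≤B n (ℕ.m⊔n≤o⇒n≤o M N p₁))))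
           (ℚ.p⊓q≤p 1ℚ (ε ℚ.* inv C)))) ⟩
  a ℚ.* b ℚ.+ δ ℚ.* C
    ≤⟨ ℚ.+-monoʳ-≤ (a ℚ.* b) (ℚ.*-monoʳ-≤-nonNeg C {{ℚ.nonNegative (ℚ.<⇒≤ 0<C)}}
         (ℚ.p⊓q≤q 1ℚ (ε ℚ.* inv C))) ⟩
  a ℚ.* b ℚ.+ (ε ℚ.* inv C) ℚ.* C
    ≡⟨ cong (a ℚ.* b ℚ.+_) (trans (*-CS.xy∙z≈x∙zy ε (inv C) C)
         (trans (cong (ε ℚ.*_) (*-inv 0<C)) (ℚ.*-identityʳ ε))) ⟩
  a ℚ.* b ℚ.+ ε ∎
  where
  open ℚ.≤-Reasoning
  C δ : ℚ
  -- Capping `δ` at `1ℚ` makes `C` a bound for a + b + `δ`; the other bound on `δ` gives `δ` `C` ≤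
  -- `ε`.
  C = A ℚ.+ B ℚ.+ 1ℚ
  δ = 1ℚ ℚ.⊓ (ε ℚ.* inv C)
  0<C : 0ℚ ℚ.< C
  0<C = ℚ.+-mono-< (ℚ.+-mono-< (ℚ.positive⁻¹ A {{A>0}}) (ℚ.positive⁻¹ B {{B>0}}))
    (ℚ.positive⁻¹ 1ℚ)
  0<δ : 0ℚ ℚ.< δ
  0<δ with ℚ.⊓-sel 1ℚ (ε ℚ.* inv C)
  ... | inj₁ e = subst (0ℚ ℚ.<_) (sym e) (ℚ.positive⁻¹ 1ℚ)
  ... | inj₂ e = subst (0ℚ ℚ.<_) (sym e)
    (*-pos 0<ε (ℚ.positive⁻¹ (inv C) {{inv-pos 0<C}}))
  expand : ∀ a b δ → (a ℚ.+ δ) ℚ.* (b ℚ.+ δ) ≡ a ℚ.* b ℚ.+ δ ℚ.* (a ℚ.+ b ℚ.+ δ)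
  expand = solve 3 (λ a b δ → (a :+ δ) :* (b :+ δ) := a :* b :+ δ :* (a :+ b :+ δ)) refl

*-monoˡ-≤ : ∀ z x y → 0ℝ ≤ z → x ≤ y → z * x ≤ z * y
*-monoˡ-≤ z x y 0≤z x≤y = 0≤y-x⇒x≤y (z * x) (z * y) (begin
  0ℝ            ≲⟨ *-nonNeg z (y - x) 0≤z (x≤y⇒0≤y-x x y x≤y) ⟩
  z * (y - x)   ≈⟨ (λ n → p[q-r]≡pq-pr (approx z n) (approx y n) (approx x n)) ⟩
  z * y - z * x ∎)
  where open ≤-Reasoning

*-monoʳ-≤ : ∀ z x y → 0ℝ ≤ z → x ≤ y → x * z ≤ y * z
*-monoʳ-≤ z x y 0≤z x≤y = begin
  x * z ≈⟨ (λ n → ℚ.*-comm (approx x n) (approx z n)) ⟩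
  z * x ≲⟨ *-monoˡ-≤ z x y 0≤z x≤y ⟩
  z * y ≈⟨ (λ n → ℚ.*-comm (approx z n) (approx y n)) ⟩
  y * z ∎
  where open ≤-Reasoning

-- Natural numbers and unit fractions as rationals and as reals.

fromℚᵘ-homo-+ : ∀ p q → ℚ.fromℚᵘ (p ℚᵘ.+ q) ≡ ℚ.fromℚᵘ p ℚ.+ ℚ.fromℚᵘ q
fromℚᵘ-homo-+ p q = ℚ.toℚᵘ-injective (begin-equality
  ℚ.toℚᵘ (ℚ.fromℚᵘ (p ℚᵘ.+ q))
    ≃⟨ ℚ.toℚᵘ-fromℚᵘ (p ℚᵘ.+ q) ⟩
  p ℚᵘ.+ q
    ≃⟨ ℚᵘ.+-cong (ℚ.toℚᵘ-fromℚᵘ p) (ℚ.toℚᵘ-fromℚᵘ q) ⟨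
  ℚ.toℚᵘ (ℚ.fromℚᵘ p) ℚᵘ.+ ℚ.toℚᵘ (ℚ.fromℚᵘ q)
    ≃⟨ ℚ.toℚᵘ-homo-+ (ℚ.fromℚᵘ p) (ℚ.fromℚᵘ q) ⟨
  ℚ.toℚᵘ (ℚ.fromℚᵘ p ℚ.+ ℚ.fromℚᵘ q) ∎)
  where open ℚᵘ.≤-Reasoning

fromℚᵘ-homo-* : ∀ p q → ℚ.fromℚᵘ (p ℚᵘ.* q) ≡ ℚ.fromℚᵘ p ℚ.* ℚ.fromℚᵘ q
fromℚᵘ-homo-* p q = ℚ.toℚᵘ-injective (begin-equality
  ℚ.toℚᵘ (ℚ.fromℚᵘ (p ℚᵘ.* q))
    ≃⟨ ℚ.toℚᵘ-fromℚᵘ (p ℚᵘ.* q) ⟩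
  p ℚᵘ.* q
    ≃⟨ ℚᵘ.*-cong (ℚ.toℚᵘ-fromℚᵘ p) (ℚ.toℚᵘ-fromℚᵘ q) ⟨
  ℚ.toℚᵘ (ℚ.fromℚᵘ p) ℚᵘ.* ℚ.toℚᵘ (ℚ.fromℚᵘ q)
    ≃⟨ ℚ.toℚᵘ-homo-* (ℚ.fromℚᵘ p) (ℚ.fromℚᵘ q) ⟨
  ℚ.toℚᵘ (ℚ.fromℚᵘ p ℚ.* ℚ.fromℚᵘ q) ∎)
  where open ℚᵘ.≤-Reasoning

_/1 : ℕ → ℚ
n /1 = ℤ.+ n ℚ./ 1

-- Normalisation by the gcd does not compute for a variable `n`. The identity is therefore checked
-- by cross-multiplication on unnormalised fractions and carried over by `fromℚᵘ-homo-+`.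
suc/1 : ∀ n → suc n /1 ≡ 1ℚ ℚ.+ n /1
suc/1 n = trans (ℚ.fromℚᵘ-cong {mkℚᵘ (ℤ.+ suc n) 0} {mkℚᵘ (ℤ.+ 1) 0 ℚᵘ.+ mkℚᵘ (ℤ.+ n) 0}
    (*≡* (cong (λ i → (ℤ.+ 1 ℤ.+ i) ℤ.* ℤ.+ 1) (sym (ℤ.*-identityʳ (ℤ.+ n))))))
  (fromℚᵘ-homo-+ (mkℚᵘ (ℤ.+ 1) 0) (mkℚᵘ (ℤ.+ n) 0))

suc/1*1/suc : ∀ n → suc n /1 ℚ.* (ℤ.+ 1 ℚ./ suc n) ≡ 1ℚ
suc/1*1/suc n = trans (sym (fromℚᵘ-homo-* (mkℚᵘ (ℤ.+ suc n) 0) (mkℚᵘ (ℤ.+ 1) n)))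
  (ℚ.fromℚᵘ-cong {mkℚᵘ (ℤ.+ suc n) 0 ℚᵘ.* mkℚᵘ (ℤ.+ 1) n} {mkℚᵘ (ℤ.+ 1) 0}
    (*≡* (begin
      ℤ.+ suc n ℤ.* ℤ.+ 1 ℤ.* ℤ.+ 1  ≡⟨ ℤ.*-identityʳ _ ⟩
      ℤ.+ suc n ℤ.* ℤ.+ 1            ≡⟨ ℤ.*-identityʳ (ℤ.+ suc n) ⟩
      ℤ.+ suc n                      ≡⟨ cong (λ m → ℤ.+ suc m) (ℕ.+-identityʳ n) ⟨
      ℤ.+ suc (n ℕ.+ 0)              ≡⟨ ℤ.*-identityˡ _ ⟨
      ℤ.+ 1 ℤ.* ℤ.+ suc (n ℕ.+ 0)    ∎)))

  where open ≡-Reasoning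

1/[m*n] : ∀ m n .{{_ : ℕ.NonZero m}} .{{_ : ℕ.NonZero n}} .{{_ : ℕ.NonZero (m ℕ.* n)}} →
  ℤ.+ 1 ℚ./ (m ℕ.* n) ≡ (ℤ.+ 1 ℚ./ m) ℚ.* (ℤ.+ 1 ℚ./ n)
1/[m*n] (suc m) (suc n) = fromℚᵘ-homo-* (mkℚᵘ (ℤ.+ 1) m) (mkℚᵘ (ℤ.+ 1) n)

0≤/1 : ∀ n → 0ℚ ℚ.≤ n /1
0≤/1 n = ℚ.nonNegative⁻¹ (n /1) {{ℚ.normalize-nonNeg n 1}}

/1-mono-≤ : ∀ {m n} → m ℕ.≤ n → m /1 ℚ.≤ n /1
/1-mono-≤ {n = n} ℕ.z≤n = 0≤/1 n
/1-mono-≤ {suc m} {suc n} (ℕ.s≤s m≤n) = subst₂ ℚ._≤_ (sym (suc/1 m)) (sym (suc/1 n))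
  (ℚ.+-monoʳ-≤ 1ℚ (/1-mono-≤ m≤n))

0≤1/ : ∀ n .{{_ : ℕ.NonZero n}} → 0ℚ ℚ.≤ ℤ.+ 1 ℚ./ n
0≤1/ n = ℚ.nonNegative⁻¹ (ℤ.+ 1 ℚ./ n) {{ℚ.normalize-nonNeg 1 n}}

1/suc≤1 : ∀ n → ℤ.+ 1 ℚ./ suc n ℚ.≤ 1ℚ
1/suc≤1 n = begin
  r                      ≡⟨ ℚ.*-identityˡ r ⟨
  1ℚ ℚ.* r               ≤⟨ ℚ.*-monoʳ-≤-nonNeg r {{ℚ.nonNegative (0≤1/ (suc n))}}
                              (/1-mono-≤ (ℕ.s≤s (ℕ.z≤n {n}))) ⟩
  suc n /1 ℚ.* r         ≡⟨ suc/1*1/suc n ⟩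
  1ℚ                     ∎
  where
  open ℚ.≤-Reasoning
  r = ℤ.+ 1 ℚ./ suc n

0≤1 : 0ℝ ≤ 1ℝ
0≤1 = fromℚ-mono-≤ (ℚ.nonNegative⁻¹ 1ℚ)

-1≤0 : - 1ℝ ≤ 0ℝ
-1≤0 = fromℚ-mono-≤ (ℚ.nonPositive⁻¹ (ℚ.- 1ℚ))

0≤1/! : ∀ m → 0ℝ ≤ 1/ m !
0≤1/! m = fromℚ-mono-≤ (0≤1/ (m !))
  where instance _ = m ℕ.!≢0

0≤fromℕ : ∀ n → 0ℝ ≤ fromℕ n
0≤fromℕ n = fromℚ-mono-≤ (0≤/1 n)

1/suc_ : ℕ → ℝ
1/suc m = fromℚ (ℤ.+ 1 ℚ./ suc m)

1/suc! : ∀ m → 1/ suc m ! ≗ (1/suc m) * 1/ m !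
1/suc! m _ = 1/[m*n] (suc m) (m !)
  where instance
    _ = m ℕ.!≢0
    _ = suc m ℕ.!≢0

-- Powers and partial sums of the exponential series.

+-nonNeg : ∀ x y → 0ℝ ≤ x → 0ℝ ≤ y → 0ℝ ≤ x + y
+-nonNeg x y 0≤x 0≤y = +-mono-≤ 0ℝ x 0ℝ y 0≤x 0≤y

^-nonNeg : ∀ x j → 0ℝ ≤ x → 0ℝ ≤ x ^ j
^-nonNeg x zero    0≤x = 0≤1
^-nonNeg x (suc j) 0≤x = *-nonNeg x (x ^ j) 0≤x (^-nonNeg x j 0≤x)

^-monoˡ-≤ : ∀ x y j → 0ℝ ≤ x → x ≤ y → x ^ j ≤ y ^ j
^-monoˡ-≤ x y zero    0≤x x≤y = ≤-refl 1ℝ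
^-monoˡ-≤ x y (suc j) 0≤x x≤y = begin
  x * x ^ j ≲⟨ *-monoˡ-≤ x (x ^ j) (y ^ j) 0≤x (^-monoˡ-≤ x y j 0≤x x≤y) ⟩
  x * y ^ j ≲⟨ *-monoʳ-≤ (y ^ j) x y (^-nonNeg y j (≤-trans 0ℝ x y 0≤x x≤y)) x≤y ⟩
  y * y ^ j ∎
  where open ≤-Reasoning

^-≤1 : ∀ x j → 0ℝ ≤ x → x ≤ 1ℝ → x ^ j ≤ 1ℝ
^-≤1 x zero    0≤x x≤1 = ≤-refl 1ℝ
^-≤1 x (suc j) 0≤x x≤1 = begin
  x * x ^ j  ≲⟨ *-monoˡ-≤ x (x ^ j) 1ℝ 0≤x (^-≤1 x j 0≤x x≤1) ⟩
  x * 1ℝ     ≈⟨ (λ n → ℚ.*-identityʳ (approx x n)) ⟩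
  x          ≲⟨ x≤1 ⟩
  1ℝ         ∎
  where open ≤-Reasoning

-- Convexity of the power function, with the tangent taken at z = x + y. The induction multiplies by
-- z = x + y; the surplus x y^(j+1) is at most x z^(j+1) because y ≤ z, which raises the coefficient
-- by one.
^-tangent : ∀ x y j → 0ℝ ≤ x → 0ℝ ≤ y →
  (x + y) ^ suc j ≤ y ^ suc j + fromℕ (suc j) * (x * (x + y) ^ j)
^-tangent x y zero 0≤x 0≤y =
  ≗⇒≤ ((x + y) ^ 1) (y ^ 1 + fromℕ 1 * (x * (x + y) ^ 0)) λ n →
    solve 2 (λ x y → (x :+ y) :* con 1ℚ := y :* con 1ℚ :+ con 1ℚ :* (x :* con 1ℚ))
      refl (approx x n) (approx y n)
^-tangent x y (suc j) 0≤x 0≤y = begin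
  z * z ^ suc j
    ≲⟨ *-monoˡ-≤ z (z ^ suc j) (y ^ suc j + N * (x * z ^ j)) 0≤z (^-tangent x y j 0≤x 0≤y) ⟩
  z * (y ^ suc j + N * (x * z ^ j))
    ≈⟨ (λ n → solve 5
         (λ x y p q N → (x :+ y) :* (p :+ N :* (x :* q))
            := (y :* p :+ N :* (x :* ((x :+ y) :* q))) :+ x :* p)
         refl (approx x n) (approx y n) (approx (y ^ suc j) n) (approx (z ^ j) n) (approx N n)) ⟩
  (y * y ^ suc j + N * (x * (z * z ^ j))) + x * y ^ suc j
    ≲⟨ +-monoʳ-≤ (y * y ^ suc j + N * (x * (z * z ^ j))) (x * y ^ suc j) (x * z ^ suc j)
         (*-monoˡ-≤ x (y ^ suc j) (z ^ suc j) 0≤x (^-monoˡ-≤ y z (suc j) 0≤y y≤z)) ⟩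
  (y * y ^ suc j + N * (x * (z * z ^ j))) + x * z ^ suc j
    ≈⟨ (λ n → trans
         (solve 4 (λ a x q N → (a :+ N :* (x :* q)) :+ x :* q := a :+ (con 1ℚ :+ N) :* (x :* q))
           refl (approx (y ^ suc (suc j)) n) (approx x n) (approx (z ^ suc j) n) (approx N n))
         (cong (λ M → approx (y ^ suc (suc j)) n ℚ.+ M ℚ.* (approx (x * z ^ suc j) n))
           (sym (suc/1 (suc j))))) ⟩
  y * y ^ suc j + fromℕ (suc (suc j)) * (x * (z * z ^ j)) ∎
  where
  open ≤-Reasoning
  z N : ℝ
  z = x + y
  N = fromℕ (suc j)
  0≤z : 0ℝ ≤ z
  0≤z = +-nonNeg x y 0≤x 0≤y
  y≤z : y ≤ z
  y≤z = begin
    y      ≈⟨ (λ n → ℚ.+-identityˡ (approx y n)) ⟨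
    0ℝ + y ≲⟨ +-monoˡ-≤ y 0ℝ x 0≤x ⟩
    x + y  ∎

expSum-monoˡ-≤ : ∀ x y m → 0ℝ ≤ x → x ≤ y → expSum x m ≤ expSum y m
expSum-monoˡ-≤ x y zero    0≤x x≤y = ≤-refl 0ℝ
expSum-monoˡ-≤ x y (suc m) 0≤x x≤y =
  +-mono-≤ (expSum x m) (expSum y m) (x ^ m * 1/ m !) (y ^ m * 1/ m !)
    (expSum-monoˡ-≤ x y m 0≤x x≤y)
    (*-monoʳ-≤ (1/ m !) (x ^ m) (y ^ m) (0≤1/! m) (^-monoˡ-≤ x y m 0≤x x≤y))

expSum-monoʳ-≤suc : ∀ x m → 0ℝ ≤ x → expSum x m ≤ expSum x (suc m)
expSum-monoʳ-≤suc x m 0≤x = begin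
  expSum x m                    ≈⟨ (λ n → ℚ.+-identityʳ (approx (expSum x m) n)) ⟨
  expSum x m + 0ℝ               ≲⟨ +-monoʳ-≤ (expSum x m) 0ℝ (x ^ m * 1/ m !)
                                     (*-nonNeg (x ^ m) (1/ m !) (^-nonNeg x m 0≤x) (0≤1/! m)) ⟩
  expSum x m + x ^ m * 1/ m !   ∎
  where open ≤-Reasoning

-- Sum of the inequalities `^-tangent` divided by factorials. Since (m+1) / (m+1)! = 1/m!,
-- differentiation lowers each degree by one, so the last sum on the right has one term fewer.
expSum-tangent : ∀ x y m → 0ℝ ≤ x → 0ℝ ≤ y →
  expSum (x + y) (suc m) ≤ expSum y (suc m) + x * expSum (x + y) m
expSum-tangent x y zero 0≤x 0≤y =
  ≗⇒≤ (expSum (x + y) 1) (expSum y 1 + x * 0ℝ) λ n →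
    solve 2 (λ a x → a := a :+ x :* con 0ℚ) refl (approx (expSum y 1) n) (approx x n)
expSum-tangent x y (suc m) 0≤x 0≤y = begin
  expSum z (suc m) + z ^ suc m * c
    ≲⟨ +-mono-≤ (expSum z (suc m)) (expSum y (suc m) + x * expSum z m)
         (z ^ suc m * c) ((y ^ suc m + N * (x * z ^ m)) * c)
         (expSum-tangent x y m 0≤x 0≤y)
         (*-monoʳ-≤ c (z ^ suc m) (y ^ suc m + N * (x * z ^ m)) (0≤1/! (suc m))
           (^-tangent x y m 0≤x 0≤y)) ⟩
  (expSum y (suc m) + x * expSum z m) + (y ^ suc m + N * (x * z ^ m)) * c
    ≈⟨ (λ n → solve 7 (λ a x e p N q c →
           (a :+ x :* e) :+ (p :+ N :* (x :* q)) :* c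
             := (a :+ p :* c) :+ x :* (e :+ q :* (N :* c)))
         refl (approx (expSum y (suc m)) n) (approx x n) (approx (expSum z m) n)
           (approx (y ^ suc m) n) (approx N n) (approx (z ^ m) n) (approx c n)) ⟩
  (expSum y (suc m) + y ^ suc m * c) + x * (expSum z m + z ^ m * (N * c))
    ≈⟨ (λ n → cong (λ d → approx (expSum y (suc (suc m))) n
         ℚ.+ approx x n ℚ.* (approx (expSum z m) n ℚ.+ approx (z ^ m) n ℚ.* d)) (N*c n)) ⟩
  (expSum y (suc m) + y ^ suc m * c) + x * (expSum z m + z ^ m * 1/ m !) ∎
  where
  open ≤-Reasoning
  z N c : ℝ
  z = x + y
  N = fromℕ (suc m)
  c = 1/ suc m !
  N*c : N * c ≗ 1/ m !
  N*c n = trans (cong (suc m /1 ℚ.*_) (1/suc! m n))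
    (trans (sym (ℚ.*-assoc (suc m /1) (approx (1/suc m) n) (approx (1/ m !) n)))
    (trans (cong (ℚ._* approx (1/ m !) n) (suc/1*1/suc m)) (ℚ.*-identityˡ _)))

1-x≥0 : ∀ x → x ≤ 1ℝ → 0ℝ ≤ 1ℝ - x
1-x≥0 x = x≤y⇒0≤y-x x 1ℝ

1-x≤1 : ∀ x → 0ℝ ≤ x → 1ℝ - x ≤ 1ℝ
1-x≤1 x = -‿monoʳ-≤ 1ℝ 0ℝ x

-- A finite form of (1 - x) e^(x+y) ≤ e^y. The terms at x + y are nonnegative, so the shorter sum in
-- `expSum-tangent` may be completed to the full one and then moved to the left.
expSum-contract : ∀ x y m → 0ℝ ≤ x → 0ℝ ≤ y →
  (1ℝ - x) * expSum (x + y) m ≤ expSum y m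
expSum-contract x y zero 0≤x 0≤y = ≗⇒≤ ((1ℝ - x) * 0ℝ) 0ℝ λ n →
  ℚ.*-zeroʳ (approx (1ℝ - x) n)
expSum-contract x y (suc m) 0≤x 0≤y = begin
  (1ℝ - x) * e′
    ≈⟨ (λ n → solve 2 (λ x e → (con 1ℚ :- x) :* e := e :- x :* e) refl
         (approx x n) (approx e′ n)) ⟩
  e′ - x * e′
    ≲⟨ +-monoˡ-≤ (- (x * e′)) e′ (d + x * e) (expSum-tangent x y m 0≤x 0≤y) ⟩
  d + x * e - x * e′
    ≲⟨ +-monoˡ-≤ (- (x * e′)) (d + x * e) (d + x * e′) (+-monoʳ-≤ d (x * e) (x * e′)
         (*-monoˡ-≤ x e e′ 0≤x
           (expSum-monoʳ-≤suc (x + y) m (+-nonNeg x y 0≤x 0≤y)))) ⟩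
  d + x * e′ - x * e′
    ≈⟨ (λ n → solve 2 (λ d a → d :+ a :- a := d) refl (approx d n) (approx (x * e′) n)) ⟩
  d ∎
  where
  open ≤-Reasoning
  d e e′ : ℝ
  d = expSum y (suc m)
  e = expSum (x + y) m
  e′ = expSum (x + y) (suc m)

-- A Horner scheme: for h ∈ [0,1] also 1 + y h / (m+1) ∈ [0,1].
expSum-horner : ∀ y h m → - 1ℝ ≤ y → y ≤ 0ℝ → 0ℝ ≤ h → h ≤ 1ℝ →
  expSum y m + (y ^ m * 1/ m !) * h ≤ 1ℝ
expSum-horner y h zero -1≤y y≤0 0≤h h≤1 = begin
  0ℝ + (1ℝ * 1/ 0 !) * h
    ≈⟨ (λ n → solve 1 (λ h → con 0ℚ :+ (con 1ℚ :* con 1ℚ) :* h := h) refl (approx h n)) ⟩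
  h  ≲⟨ h≤1 ⟩
  1ℝ ∎
  where open ≤-Reasoning
expSum-horner y h (suc m) -1≤y y≤0 0≤h h≤1 = begin
  (e + p * c) + (y * p * 1/ suc m !) * h
    ≈⟨ (λ n → cong (λ d → approx (e + p * c) n ℚ.+ (approx (y * p) n ℚ.* d) ℚ.* approx h n)
         (1/suc! m n)) ⟩
  (e + p * c) + (y * p * (r * c)) * h
    ≈⟨ (λ n → solve 6 (λ e p c y r h → (e :+ p :* c) :+ (y :* p :* (r :* c)) :* h
           := e :+ (p :* c) :* (con 1ℚ :+ y :* (r :* h)))
         refl (approx e n) (approx p n) (approx c n) (approx y n) (approx r n) (approx h n)) ⟩
  e + (p * c) * (1ℝ + y * (r * h))
    ≲⟨ expSum-horner y (1ℝ + y * (r * h)) m -1≤y y≤0 0≤1+yrh 1+yrh≤1 ⟩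
  1ℝ ∎
  where
  open ≤-Reasoning
  e p c r : ℝ
  e = expSum y m
  p = y ^ m
  c = 1/ m !
  r = 1/suc m
  0≤r : 0ℝ ≤ r
  0≤r = fromℚ-mono-≤ (0≤1/ (suc m))
  0≤rh : 0ℝ ≤ r * h
  0≤rh = *-nonNeg r h 0≤r 0≤h
  rh≤1 : r * h ≤ 1ℝ
  rh≤1 = begin
    r * h    ≲⟨ *-monoˡ-≤ r h 1ℝ 0≤r h≤1 ⟩
    r * 1ℝ   ≈⟨ (λ n → ℚ.*-identityʳ (approx r n)) ⟩
    r        ≲⟨ fromℚ-mono-≤ (1/suc≤1 m) ⟩
    1ℝ       ∎
  0≤1+yrh : 0ℝ ≤ 1ℝ + y * (r * h)
  0≤1+yrh = begin
    0ℝ                     ≲⟨ 1-x≥0 (r * h) rh≤1 ⟩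
    1ℝ - r * h             ≈⟨ (λ n → solve 1 (λ a → con 1ℚ :- a := con 1ℚ :+ (:- con 1ℚ) :* a)
                                refl (approx (r * h) n)) ⟩
    1ℝ + (- 1ℝ) * (r * h)  ≲⟨ +-monoʳ-≤ 1ℝ ((- 1ℝ) * (r * h)) (y * (r * h))
                                (*-monoʳ-≤ (r * h) (- 1ℝ) y 0≤rh -1≤y) ⟩
    1ℝ + y * (r * h)       ∎
  1+yrh≤1 : 1ℝ + y * (r * h) ≤ 1ℝ
  1+yrh≤1 = begin
    1ℝ + y * (r * h)       ≲⟨ +-monoʳ-≤ 1ℝ (y * (r * h)) (0ℝ * (r * h))
                                (*-monoʳ-≤ (r * h) y 0ℝ 0≤rh y≤0) ⟩
    1ℝ + 0ℝ * (r * h)      ≈⟨ (λ n → solve 1 (λ a → con 1ℚ :+ con 0ℚ :* a := con 1ℚ)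
                                refl (approx (r * h) n)) ⟩
    1ℝ                     ∎

expSum-nonPos≤1 : ∀ y m → - 1ℝ ≤ y → y ≤ 0ℝ → expSum y m ≤ 1ℝ
expSum-nonPos≤1 y m -1≤y y≤0 = begin
  expSum y m
    ≈⟨ (λ n → solve 2 (λ e t → e := e :+ t :* con 0ℚ) refl
         (approx (expSum y m) n) (approx (y ^ m * 1/ m !) n)) ⟩
  expSum y m + (y ^ m * 1/ m !) * 0ℝ
    ≲⟨ expSum-horner y 0ℝ m -1≤y y≤0 (≤-refl 0ℝ) 0≤1 ⟩
  1ℝ ∎
  where open ≤-Reasoning

-- Each factor 1 - x absorbs one of the `t` summands of t x, by `expSum-contract`, until the
-- argument is 0.
[1-x]^t*expSum[tx]≤1 : ∀ x t m → 0ℝ ≤ x → x ≤ 1ℝ →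
  (1ℝ - x) ^ t * expSum (fromℕ t * x) m ≤ 1ℝ
[1-x]^t*expSum[tx]≤1 x zero m 0≤x x≤1 = begin
  -- The sum at 0 is bounded as a case of a nonpositive argument, which also covers the empty sum at
  -- `m` = 0.
  (1ℝ - x) ^ 0 * expSum 0x m  ≈⟨ (λ n → ℚ.*-identityˡ (approx (expSum 0x m) n)) ⟩
  expSum 0x m                 ≲⟨ expSum-nonPos≤1 0x m
                                   (≤-trans (- 1ℝ) 0ℝ 0x -1≤0 (≗⇒≤ 0ℝ 0x λ n → sym (0x≗0 n)))
                                   (≗⇒≤ 0x 0ℝ 0x≗0) ⟩
  1ℝ                          ∎
  where
  open ≤-Reasoning
  0x : ℝ
  0x = fromℕ 0 * x
  0x≗0 : 0x ≗ 0ℝ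
  0x≗0 n = ℚ.*-zeroˡ (approx x n)
[1-x]^t*expSum[tx]≤1 x (suc t) m 0≤x x≤1 = begin
  (1ℝ - x) ^ suc t * expSum (fromℕ (suc t) * x) m
    -- The two arguments agree termwise; monotonicity of the partial sums transfers this to their
    -- values.
    ≲⟨ *-monoˡ-≤ ((1ℝ - x) ^ suc t) (expSum (fromℕ (suc t) * x) m) (expSum (x + tx) m)
         (^-nonNeg (1ℝ - x) (suc t) 0≤1-x)
         (expSum-monoˡ-≤ (fromℕ (suc t) * x) (x + tx) m
           (*-nonNeg (fromℕ (suc t)) x (0≤fromℕ (suc t)) 0≤x)
           (≗⇒≤ (fromℕ (suc t) * x) (x + tx) λ n → trans (cong (ℚ._* approx x n) (suc/1 t))
             (solve 2 (λ t x → (con 1ℚ :+ t) :* x := x :+ t :* x) refl (t /1) (approx x n)))) ⟩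
  (1ℝ - x) ^ suc t * expSum (x + tx) m
    ≈⟨ (λ n → solve 3 (λ d c e → d :* c :* e := c :* (d :* e)) refl
         (approx (1ℝ - x) n) (approx c n) (approx (expSum (x + tx) m) n)) ⟩
  c * ((1ℝ - x) * expSum (x + tx) m)
    ≲⟨ *-monoˡ-≤ c ((1ℝ - x) * expSum (x + tx) m) (expSum tx m) 0≤c
         (expSum-contract x tx m 0≤x (*-nonNeg (fromℕ t) x (0≤fromℕ t) 0≤x)) ⟩
  c * expSum tx m
    ≲⟨ [1-x]^t*expSum[tx]≤1 x t m 0≤x x≤1 ⟩
  1ℝ ∎
  where
  open ≤-Reasoning
  c tx : ℝ
  c = (1ℝ - x) ^ t
  tx = fromℕ t * x
  0≤1-x : 0ℝ ≤ 1ℝ - x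
  0≤1-x = 1-x≥0 x x≤1
  0≤c : 0ℝ ≤ c
  0≤c = ^-nonNeg (1ℝ - x) t 0≤1-x

-- For `y` ≥ 0 the partial sums increase with the argument, which may thus be raised to t x. For `y`
-- ≤ 0 both factors are at most 1, the sum by `expSum-nonPos≤1`.
[1-x]^t*expSum≤1 : ∀ x t y m → 0ℝ ≤ x → x ≤ 1ℝ → - 1ℝ ≤ y → y ≤ fromℕ t * x →
  (1ℝ - x) ^ t * expSum y m ≤ 1ℝ
[1-x]^t*expSum≤1 x t y m 0≤x x≤1 -1≤y y≤tx = by-cases 0ℝ y (c * expSum y m) 1ℝ
  (λ 0≤y → begin
    c * expSum y m              ≲⟨ *-monoˡ-≤ c (expSum y m) (expSum (fromℕ t * x) m) 0≤c
                                     (expSum-monoˡ-≤ y (fromℕ t * x) m 0≤y y≤tx) ⟩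
    c * expSum (fromℕ t * x) m  ≲⟨ [1-x]^t*expSum[tx]≤1 x t m 0≤x x≤1 ⟩
    1ℝ                          ∎)
  (λ y≤0 → begin
    c * expSum y m              ≲⟨ *-monoˡ-≤ c (expSum y m) 1ℝ 0≤c (expSum-nonPos≤1 y m -1≤y y≤0) ⟩
    c * 1ℝ                      ≈⟨ (λ n → ℚ.*-identityʳ (approx c n)) ⟩
    c                           ≲⟨ ^-≤1 (1ℝ - x) t (1-x≥0 x x≤1) (1-x≤1 x 0≤x) ⟩
    1ℝ                          ∎)
  where
  open ≤-Reasoning
  c : ℝ
  c = (1ℝ - x) ^ t
  0≤c : 0ℝ ≤ c
  0≤c = ^-nonNeg (1ℝ - x) t (1-x≥0 x x≤1)

-- Limits and division.

≤-+ε : ∀ x y → (∀ ε → 0ℚ ℚ.< ε → x ≤ y + fromℚ ε) → x ≤ y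
≤-+ε x y x≤y+ε ε 0<ε =
  -- One half of `ε` is spent on the hypothesis, the other on the slack in the definition of `_≤_`.
  let N , p = x≤y+ε (½ ℚ.* ε) (0<½*ε 0<ε) (½ ℚ.* ε) (0<½*ε 0<ε)
  in N , λ n N≤n → ℚ.≤-trans (p n N≤n) (ℚ.≤-reflexive
       (trans (ℚ.+-assoc (approx y n) _ _) (cong (approx y n ℚ.+_) (½ε+½ε ε))))

⟶-≤ : ∀ s y → s ⟶ y → ∀ ε → 0ℚ ℚ.< ε → ∃[ m ] y ≤ s m + fromℚ ε
⟶-≤ s y s⟶y ε 0<ε =
  let m , close = s⟶y (fromℚ ε) (ε , 0<ε , 0 , λ _ _ → ℚ.≤-reflexive (ℚ.+-identityˡ ε))
  in m , (begin
    y                    ≈⟨ (λ n → solve 2 (λ a y → y := a :+ (:- (a :- y))) refl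
                              (approx (s m) n) (approx y n)) ⟩
    s m + - (s m - y)    ≲⟨ +-monoʳ-≤ (s m) (- (s m - y)) (abs (s m - y))
                              (eventually-≤⇒≤ (- (s m - y)) (abs (s m - y)) 0 λ n _ →
                                ℚ.p≤q⊔p (approx (s m - y) n) (approx (- (s m - y)) n)) ⟩
    s m + abs (s m - y)  ≲⟨ +-monoʳ-≤ (s m) (abs (s m - y)) (fromℚ ε)
                              (<⇒≤ (abs (s m - y)) (fromℚ ε) (close m ℕ.≤-refl)) ⟩
    s m + fromℚ ε        ∎)
  where open ≤-Reasoning

-- Passes from partial sums to the limit: `y` exceeds some term of `s` by at most ε, and `c` ≤ 1
-- keeps the error c ε below ε.
*-limit-≤ : ∀ s y c b → s ⟶ y → 0ℝ ≤ c → c ≤ 1ℝ → (∀ m → c * s m ≤ b) → c * y ≤ b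
*-limit-≤ s y c b s⟶y 0≤c c≤1 cs≤b = ≤-+ε (c * y) b λ ε 0<ε →
  let m , y≤sm+ε = ⟶-≤ s y s⟶y ε 0<ε
  in begin
    c * y                    ≲⟨ *-monoˡ-≤ c y (s m + fromℚ ε) 0≤c y≤sm+ε ⟩
    c * (s m + fromℚ ε)      ≈⟨ (λ n → ℚ.*-distribˡ-+ (approx c n) (approx (s m) n) ε) ⟩
    c * s m + c * fromℚ ε    ≲⟨ +-mono-≤ (c * s m) b (c * fromℚ ε) (1ℝ * fromℚ ε) (cs≤b m)
                                  (*-monoʳ-≤ (fromℚ ε) c 1ℝ (fromℚ-mono-≤ (ℚ.<⇒≤ 0<ε)) c≤1) ⟩
    b + 1ℝ * fromℚ ε         ≈⟨ (λ n → cong (approx b n ℚ.+_) (ℚ.*-identityˡ ε)) ⟩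
    b + fromℚ ε              ∎
  where open ≤-Reasoning

eventually-positive : ∀ y (0<y : 0ℝ < y) n → proj₁ (proj₂ (proj₂ 0<y)) ℕ.≤ n →
  0ℚ ℚ.< approx y n
eventually-positive y (ε , 0<ε , N , ε≤y) n N≤n =
  ℚ.<-≤-trans (subst (0ℚ ℚ.<_) (sym (ℚ.+-identityˡ ε)) 0<ε) (ε≤y n N≤n)

-- The index is the one stored in the proof of 0 < y. Before it an approximation of `y` may be 0,
-- where `inv` returns 0 and nothing cancels; hence an equality of tails and not `≗`.
÷-*-cancel : ∀ x y (0<y : 0ℝ < y) n → proj₁ (proj₂ (proj₂ 0<y)) ℕ.≤ n →
  approx ((x ÷ y [ 0<y ]) * y) n ≡ approx x n
÷-*-cancel x y 0<y n N≤n = begin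
  (a ℚ.* inv b) ℚ.* b  ≡⟨ *-CS.xy∙z≈x∙zy a (inv b) b ⟩
  a ℚ.* (b ℚ.* inv b)  ≡⟨ cong (a ℚ.*_) (*-inv (eventually-positive y 0<y n N≤n)) ⟩
  a ℚ.* 1ℚ             ≡⟨ ℚ.*-identityʳ a ⟩
  a                    ∎
  where
  open ≡-Reasoning
  a = approx x n
  b = approx y n

x≤x÷y*y : ∀ x y (0<y : 0ℝ < y) → x ≤ (x ÷ y [ 0<y ]) * y
x≤x÷y*y x y 0<y = eventually-≤⇒≤ x ((x ÷ y [ 0<y ]) * y) _ λ n N≤n →
  ℚ.≤-reflexive (sym (÷-*-cancel x y 0<y n N≤n))

x÷y*y≤x : ∀ x y (0<y : 0ℝ < y) → (x ÷ y [ 0<y ]) * y ≤ x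
x÷y*y≤x x y 0<y = eventually-≤⇒≤ ((x ÷ y [ 0<y ]) * y) x _ λ n N≤n →
  ℚ.≤-reflexive (÷-*-cancel x y 0<y n N≤n)

1÷-nonNeg : ∀ y (0<y : 0ℝ < y) → 0ℝ ≤ 1ℝ ÷ y [ 0<y ]
1÷-nonNeg y 0<y = eventually-≤⇒≤ 0ℝ (1ℝ ÷ y [ 0<y ]) _ λ n N≤n →
  ℚ.≤-trans (ℚ.<⇒≤ (ℚ.positive⁻¹ (inv (approx y n))
                     {{inv-pos (eventually-positive y 0<y n N≤n)}}))
            (ℚ.≤-reflexive (sym (ℚ.*-identityˡ _)))

1≤x⇒0<x : ∀ x → 1ℝ ≤ x → 0ℝ < x
1≤x⇒0<x x 1≤x =
  let N , p = 1≤x ½ (ℚ.positive⁻¹ ½)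
  in ½ , ℚ.positive⁻¹ ½ , N , λ n N≤n → begin
    -- The sum 0 + ½ is 1 - ½ by computation, and 1 ≤ x + ½ holds at index `n`.
    0ℚ ℚ.+ ½                  ≤⟨ ℚ.+-monoˡ-≤ (ℚ.- ½) (p n N≤n) ⟩
    approx x n ℚ.+ ½ ℚ.- ½    ≡⟨ solve 1 (λ x → x :+ con ½ :- con ½ := x) refl (approx x n) ⟩
    approx x n                ∎
  where open ℚ.≤-Reasoning

-- Maxima of lists, and cardinalities along a greedy run.

⊔-lub : ∀ x y z → x ≤ z → y ≤ z → x ⊔ y ≤ z
⊔-lub x y z x≤z y≤z ε 0<ε =
  let M , p = x≤z ε 0<ε
      N , q = y≤z ε 0<ε
  in M ℕ.⊔ N , λ n h → ℚ.⊔-lub {_} {approx x n} {approx y n}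
       (p n (ℕ.m⊔n≤o⇒m≤o M N h)) (q n (ℕ.m⊔n≤o⇒n≤o M N h))

-- The bound 0 ≤ `M` takes care of the default value 0 on the empty list, which occurs below when S*
-- is contained in S.
maximum-lub : ∀ {A : Set} (g : A → ℝ) M → 0ℝ ≤ M → (∀ i → g i ≤ M) →
  ∀ xs → maximum (map g xs) ≤ M
maximum-lub g M 0≤M g≤M []       = 0≤M
maximum-lub g M 0≤M g≤M (x ∷ xs) = go xs
  where
  go : ∀ xs → foldr _⊔_ (g x) (map g xs) ≤ M
  go []       = g≤M x
  go (y ∷ ys) = ⊔-lub (g y) (foldr _⊔_ (g x) (map g ys)) M (g≤M y) (go ys)

∣p∪q∣≤∣p∣+∣q∣ : ∀ {n} (p q : Subset n) → ∣ p ∪ q ∣ ℕ.≤ ∣ p ∣ ℕ.+ ∣ q ∣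
∣p∪q∣≤∣p∣+∣q∣ []          []          = ℕ.z≤n
∣p∪q∣≤∣p∣+∣q∣ (false ∷ p) (false ∷ q) = ∣p∪q∣≤∣p∣+∣q∣ p q
∣p∪q∣≤∣p∣+∣q∣ (false ∷ p) (true  ∷ q) =
  ℕ.≤-trans (ℕ.s≤s (∣p∪q∣≤∣p∣+∣q∣ p q)) (ℕ.≤-reflexive (sym (ℕ.+-suc ∣ p ∣ ∣ q ∣)))
∣p∪q∣≤∣p∣+∣q∣ (true  ∷ p) (false ∷ q) = ℕ.s≤s (∣p∪q∣≤∣p∣+∣q∣ p q)
∣p∪q∣≤∣p∣+∣q∣ (true  ∷ p) (true  ∷ q) = ℕ.s≤s
  (ℕ.≤-trans (∣p∪q∣≤∣p∣+∣q∣ p q) (ℕ.+-monoʳ-≤ ∣ p ∣ (ℕ.n≤1+n ∣ q ∣)))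

Greedy-∣∣ : ∀ {n} {f : Subset n → ℝ} {S₀ t S} → Greedy f S₀ t S → ∣ S ∣ ℕ.≤ ∣ S₀ ∣ ℕ.+ t
Greedy-∣∣ {S₀ = S₀} start = ℕ.m≤m+n ∣ S₀ ∣ 0
Greedy-∣∣ {S₀ = S₀} (step {t} {S} run i _) = begin
  ∣ S ∪ ⁅ i ⁆ ∣        ≤⟨ ∣p∪q∣≤∣p∣+∣q∣ S ⁅ i ⁆ ⟩
  ∣ S ∣ ℕ.+ ∣ ⁅ i ⁆ ∣  ≡⟨ cong (∣ S ∣ ℕ.+_) (∣⁅x⁆∣≡1 i) ⟩
  ∣ S ∣ ℕ.+ 1          ≡⟨ ℕ.+-comm ∣ S ∣ 1 ⟩
  suc ∣ S ∣            ≤⟨ ℕ.s≤s (Greedy-∣∣ run) ⟩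
  suc (∣ S₀ ∣ ℕ.+ t)   ≡⟨ ℕ.+-suc ∣ S₀ ∣ t ⟨
  ∣ S₀ ∣ ℕ.+ suc t     ∎
  where open ℕ.≤-Reasoning

-- Decay of the gap to the optimum along a greedy run.

module _ {n} (f : Subset n → ℝ) (α : ℝ) (1≤α : 1ℝ ≤ α)
         (nonInc : NonIncreasing f) (weak : WeaklySupermodular f α)
         (k : ℕ) (S* : Subset n) (∣S*∣≤k : ∣ S* ∣ ℕ.≤ k) where

  private
    0≤α : 0ℝ ≤ α
    0≤α = ≤-trans 0ℝ 1ℝ α 0≤1 1≤α

  -- Weak supermodularity bounds the decrease from S to S ∪ S*. Minimality of `i` bounds every
  -- single-element gain by that of `i`, and at most `k` elements of S* lie outside S.
  argmin-gain : ∀ S i → IsArgmin f S i →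
    f S - f S* ≤ α * fromℕ k * (f S - f (S ∪ ⁅ i ⁆))
  argmin-gain S i argmin = begin
    f S - f S*
      ≲⟨ -‿monoʳ-≤ (f S) (f (S ∪ S*)) (f S*)
           -- Monotonicity speaks of S* ∪ S, weak supermodularity of S ∪ S*.
           (subst (λ T → f T ≤ f S*) (∪-comm S* S) (nonInc S* S)) ⟩
    f S - f (S ∪ S*)
      ≲⟨ weak S S* ⟩
    α * N * (max[ S* ─ S ] λ j → f S - f (S ∪ ⁅ j ⁆))
      ≲⟨ *-monoˡ-≤ (α * N) (max[ S* ─ S ] λ j → f S - f (S ∪ ⁅ j ⁆)) gain
           (*-nonNeg α N 0≤α (0≤fromℕ ∣ S* ─ S ∣))
           (maximum-lub (λ j → f S - f (S ∪ ⁅ j ⁆)) gain 0≤gain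
             (λ j → -‿monoʳ-≤ (f S) (f (S ∪ ⁅ i ⁆)) (f (S ∪ ⁅ j ⁆)) (argmin j))
             (elements (S* ─ S))) ⟩
    α * N * gain
      ≲⟨ *-monoʳ-≤ gain (α * N) (α * fromℕ k) 0≤gain
           (*-monoˡ-≤ α N (fromℕ k) 0≤α (fromℚ-mono-≤ (/1-mono-≤
             (ℕ.≤-trans (∣p─q∣≤∣p∣ S* S) ∣S*∣≤k)))) ⟩
    α * fromℕ k * gain ∎
    where
    open ≤-Reasoning
    N gain : ℝ
    N = fromℕ ∣ S* ─ S ∣
    gain = f S - f (S ∪ ⁅ i ⁆)
    0≤gain : 0ℝ ≤ gain
    0≤gain = x≤y⇒0≤y-x (f (S ∪ ⁅ i ⁆)) (f S) (nonInc S ⁅ i ⁆)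

  -- Used with x = 1/K for K = αk. By `argmin-gain` a step gains at least `x` times the current gap,
  -- which leaves at most the fraction 1 - x. The initial gap is at most `f S₀` because `f S*` is
  -- nonnegative.
  Greedy-decay : 0ℝ ≤ f S* → ∀ x → 0ℝ ≤ x → x ≤ 1ℝ → x * (α * fromℕ k) ≤ 1ℝ →
    ∀ {S₀ t S} → Greedy f S₀ t S → f S - f S* ≤ (1ℝ - x) ^ t * f S₀
  Greedy-decay 0≤fS* x 0≤x x≤1 xK≤1 {S₀} start = begin
    f S₀ - f S*          ≲⟨ -‿monoʳ-≤ (f S₀) 0ℝ (f S*) 0≤fS* ⟩
    f S₀ - 0ℝ            ≈⟨ (λ n → solve 1 (λ a → a :- con 0ℚ := con 1ℚ :* a) refl
                              (approx (f S₀) n)) ⟩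
    (1ℝ - x) ^ 0 * f S₀  ∎
    where open ≤-Reasoning
  Greedy-decay 0≤fS* x 0≤x x≤1 xK≤1 {S₀} (step {t} {S} run i argmin) = begin
    f S′ - f S*
      ≈⟨ (λ n → solve 3 (λ a b c → b :- c := (a :- c) :- con 1ℚ :* (a :- b)) refl
           (approx (f S) n) (approx (f S′) n) (approx (f S*) n)) ⟩
    d - 1ℝ * gain
      ≲⟨ -‿monoʳ-≤ d (x * d) (1ℝ * gain) xd≤gain ⟩
    d - x * d
      ≈⟨ (λ n → solve 2 (λ d x → d :- x :* d := (con 1ℚ :- x) :* d) refl
           (approx d n) (approx x n)) ⟩
    (1ℝ - x) * d
      ≲⟨ *-monoˡ-≤ (1ℝ - x) d ((1ℝ - x) ^ t * f S₀) (1-x≥0 x x≤1)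
           (Greedy-decay 0≤fS* x 0≤x x≤1 xK≤1 run) ⟩
    (1ℝ - x) * ((1ℝ - x) ^ t * f S₀)
      ≈⟨ (λ n → ℚ.*-assoc (approx (1ℝ - x) n) (approx ((1ℝ - x) ^ t) n) (approx (f S₀) n)) ⟨
    (1ℝ - x) ^ suc t * f S₀ ∎
    where
    open ≤-Reasoning
    S′ = S ∪ ⁅ i ⁆
    K d gain : ℝ
    K = α * fromℕ k
    d = f S - f S*
    gain = f S - f S′
    0≤gain : 0ℝ ≤ gain
    0≤gain = x≤y⇒0≤y-x (f S′) (f S) (nonInc S ⁅ i ⁆)
    xd≤gain : x * d ≤ 1ℝ * gain
    xd≤gain = begin
      x * d           ≲⟨ *-monoˡ-≤ x d (K * gain) 0≤x (argmin-gain S i argmin) ⟩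
      x * (K * gain)  ≈⟨ (λ n → ℚ.*-assoc (approx x n) (approx K n) (approx gain n)) ⟨
      x * K * gain    ≲⟨ *-monoʳ-≤ gain (x * K) 1ℝ 0≤gain xK≤1 ⟩
      1ℝ * gain       ∎

-- Bounds on the logarithm from its ceiling, and the final estimate.

-- Division of K y ≤ b by K, with `x` as the reciprocal. Multiplying 1 ≤ x K by `y` requires `y` ≥
-- 0; for `y` ≤ 0 the right-hand side is nonnegative anyway.
≤-*-reciprocal : ∀ K x y b → 0ℝ ≤ x → 1ℝ ≤ x * K → 0ℝ ≤ b → K * y ≤ b → y ≤ b * x
≤-*-reciprocal K x y b 0≤x 1≤xK 0≤b Ky≤b = by-cases 0ℝ y y (b * x)
  (λ 0≤y → begin
    y            ≈⟨ (λ n → ℚ.*-identityˡ (approx y n)) ⟨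
    1ℝ * y       ≲⟨ *-monoʳ-≤ y 1ℝ (x * K) 0≤y 1≤xK ⟩
    x * K * y    ≈⟨ (λ n → ℚ.*-assoc (approx x n) (approx K n) (approx y n)) ⟩
    x * (K * y)  ≲⟨ *-monoˡ-≤ x (K * y) b 0≤x Ky≤b ⟩
    x * b        ≈⟨ (λ n → ℚ.*-comm (approx x n) (approx b n)) ⟩
    b * x        ∎)
  (λ y≤0 → ≤-trans y 0ℝ (b * x) y≤0 (*-nonNeg b x 0≤b 0≤x))
  where open ≤-Reasoning

-- The ceiling `t` is a natural number, so K y > t - 1 ≥ -1; for `y` ≤ 0 and K ≥ 1 also K y ≤ y.
ceiling⇒-1≤ : ∀ K y t → 1ℝ ≤ K → IsCeiling (K * y) (ℤ.+ t) → - 1ℝ ≤ y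
ceiling⇒-1≤ K y t 1≤K (t-1<Ky , _) = by-cases 0ℝ y (- 1ℝ) y
  (≤-trans (- 1ℝ) 0ℝ y -1≤0)
  (λ y≤0 → begin
    - 1ℝ             ≈⟨ (λ _ → refl) ⟩
    0ℝ - 1ℝ          ≲⟨ +-monoˡ-≤ (- 1ℝ) 0ℝ (fromℕ t) (0≤fromℕ t) ⟩
    fromℕ t - 1ℝ     ≲⟨ <⇒≤ (fromℕ t - 1ℝ) (K * y) t-1<Ky ⟩
    K * y            ≈⟨ (λ n → solve 2 (λ K y → K :* y := :- (K :* (:- y))) refl
                          (approx K n) (approx y n)) ⟩
    - (K * (- y))    ≲⟨ neg-antimono-≤ (1ℝ * (- y)) (K * (- y))
                          (*-monoʳ-≤ (- y) 1ℝ K (neg-antimono-≤ y 0ℝ y≤0) 1≤K) ⟩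
    - (1ℝ * (- y))   ≈⟨ (λ n → solve 1 (λ y → :- (con 1ℚ :* (:- y)) := y) refl (approx y n)) ⟩
    y                ∎)
  where open ≤-Reasoning

theorem1 : ∀ {n} (f : Subset n → ℝ) (α : ℝ) → 1ℝ ≤ α →
    NonNegative f → NonIncreasing f → WeaklySupermodular f α →
    (k : ℕ) → 1 ℕ.≤ k →
    (S* : Subset n) → IsOptimal f k S* →
    (S₀ : Subset n) → 0ℝ < f S₀ →
    (E : ℝ) (0<E : 0ℝ < E) →
    (L : ℝ) → IsLn (f S₀ ÷ E [ 0<E ]) L →
    (τ : ℕ) → IsCeiling (α * fromℕ k * L) (ℤ.+ τ) →
    (Sτ : Subset n) → Greedy f S₀ τ Sτ →
    ∣ Sτ ∣ ℕ.≤ ∣ S₀ ∣ ℕ.+ τ × f Sτ ≤ f S* + E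
theorem1 f α 1≤α nonNeg nonInc weak k 1≤k S* (∣S*∣≤k , _) S₀ _ E 0<E L lnQ≡L τ ⌈KL⌉≡τ Sτ run =
  Greedy-∣∣ run , (begin
    f Sτ                    ≈⟨ (λ n → q+[p-q]≡p (approx (f Sτ) n) (approx (f S*) n)) ⟨
    f S* + (f Sτ - f S*)    ≲⟨ +-monoʳ-≤ (f S*) (f Sτ - f S*) E gap≤E ⟩
    f S* + E                ∎)
  where
  open ≤-Reasoning
  K Q : ℝ
  K = α * fromℕ k
  Q = f S₀ ÷ E [ 0<E ]
  1≤K : 1ℝ ≤ K
  1≤K = begin
    1ℝ           ≲⟨ 1≤α ⟩
    α            ≈⟨ (λ n → ℚ.*-identityʳ (approx α n)) ⟨
    α * 1ℝ       ≲⟨ *-monoˡ-≤ α 1ℝ (fromℕ k) (≤-trans 0ℝ 1ℝ α 0≤1 1≤α)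
                      (fromℚ-mono-≤ (/1-mono-≤ 1≤k)) ⟩
    α * fromℕ k  ∎
  0<K : 0ℝ < K
  0<K = 1≤x⇒0<x K 1≤K
  x : ℝ
  x = 1ℝ ÷ K [ 0<K ]
  0≤x : 0ℝ ≤ x
  0≤x = 1÷-nonNeg K 0<K
  x≤1 : x ≤ 1ℝ
  x≤1 = begin
    x       ≈⟨ (λ n → ℚ.*-identityʳ (approx x n)) ⟨
    x * 1ℝ  ≲⟨ *-monoˡ-≤ x 1ℝ K 0≤x 1≤K ⟩
    x * K   ≲⟨ x÷y*y≤x 1ℝ K 0<K ⟩
    1ℝ      ∎
  c : ℝ
  c = (1ℝ - x) ^ τ
  0≤c : 0ℝ ≤ c
  0≤c = ^-nonNeg (1ℝ - x) τ (1-x≥0 x x≤1)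
  c*Q≤1 : c * Q ≤ 1ℝ
  -- The exponential series of `L` converges to `Q`, so a bound on `c` times every partial sum at
  -- `L` passes to `c * Q`.
  c*Q≤1 = *-limit-≤ (expSum L) Q c 1ℝ lnQ≡L 0≤c (^-≤1 (1ℝ - x) τ (1-x≥0 x x≤1) (1-x≤1 x 0≤x))
    λ m → [1-x]^t*expSum≤1 x τ L m 0≤x x≤1
      -- The halves of the ceiling bound `L` on both sides: τ - 1 < K L yields -1 ≤ L, and K L ≤ τ
      -- yields L ≤ τ x.
      (ceiling⇒-1≤ K L τ 1≤K ⌈KL⌉≡τ)
      (≤-*-reciprocal K x L (fromℕ τ) 0≤x (x≤x÷y*y 1ℝ K 0<K) (0≤fromℕ τ) (proj₂ ⌈KL⌉≡τ))
  gap≤E : f Sτ - f S* ≤ E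
  gap≤E = begin
    f Sτ - f S*  ≲⟨ Greedy-decay f α 1≤α nonInc weak k S* ∣S*∣≤k (nonNeg S*)
                      x 0≤x x≤1 (x÷y*y≤x 1ℝ K 0<K) run ⟩
    c * f S₀     ≲⟨ *-monoˡ-≤ c (f S₀) (Q * E) 0≤c (x≤x÷y*y (f S₀) E 0<E) ⟩
    c * (Q * E)  ≈⟨ (λ n → ℚ.*-assoc (approx c n) (approx Q n) (approx E n)) ⟨
    c * Q * E    ≲⟨ *-monoʳ-≤ E (c * Q) 1ℝ (<⇒≤ 0ℝ E 0<E) c*Q≤1 ⟩
    1ℝ * E       ≈⟨ (λ n → ℚ.*-identityˡ (approx E n)) ⟩
    E            ∎
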